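{- Let $G=(V,E)$ be a finite simple graph with $d$ vertices. Then $$A_G(V)=\sum_{\pi\in L_G}(-1)^{d-|\pi|}\mu_G(\hat{0},\pi)\prod_{B\in\pi}v_B .$$
   Context: An orientation of $G$ assigns a direction to each edge; it is acyclic if it has no directed cycles. $\mathcal{A}(G)$ is the set of acyclic orientations of $G$. For $\mathfrak{o}\in\mathcal{A}(G)$, a vertex $v$ is a sink if every edge incident with $v$ is directed toward $v$ (in particular, isolated vertices are sinks); $\operatorname{Sink}(\mathfrak{o})$ is the set of sinks of $\mathfrak{o}$. To each vertex $v\in V$ associate a commuting variable, also denoted $v$, and let $\mathbb{Z}[V]$ be the polynomial ring in these variables. The acyclic orientation polynomial of $G$ is $$A_G(V)=\sum_{\mathfrak{o}\in\mathcal{A}(G)}\ \prod_{v\in\operatorname{Sink}(\mathfrak{o})}v\ \in\mathbb{Z}[V].$$ A vertex partition $\pi$ is a set of mutually disjoint non-empty subsets of $V$ (called blocks) whose union is $V$; $|\pi|$ is its number of blocks. A bond is a vertex partition each of whose blocks induces a connected subgraph of $G$. $L_G$ is the set of bonds of $G$, partially ordered by refinement (the bond lattice); its least element $\hat{0}$ is the bond all of whose blocks are singletons. $\mu_G$ is the M\"obius function of the poset $L_G$: $\mu_G(\sigma,\sigma)=1$, $\mu_G(\sigma,\pi)=-\sum_{\sigma\le\tau<\pi}\mu_G(\sigma,\tau)$ if $\sigma<\pi$, and $\mu_G(\sigma,\pi)=0$ otherwise. For a block $B\subseteq V$, put $$v_B=1-\prod_{v\in B}(1-v)\in\mathbb{Z}[V].$$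 -}

module Defs where

open import Data.Bool.Base using (if_then_else_)
open import Data.Bool.Properties as Bool using ()
open import Data.Empty using (⊥-elim)
open import Data.Fin.Base as Fin using (Fin)
open import Data.Fin.Properties as Fin using (all?)
open import Data.Fin.Subset
  using (Subset; inside; outside; _∈_; _⊆_; _⊂_; _∩_; ⋃; ⊤; ∣_∣; Nonempty; Empty)
open import Data.Fin.Subset.Induction using (⊂-wellFounded)
open import Data.Fin.Subset.Properties
  using (_∈?_; _⊆?_; nonempty?; ⊆-refl)
open import Data.Integer.Base as ℤ using (ℤ; 0ℤ; 1ℤ)
open import Data.List.Base as List
  using (List; []; _∷_; _++_; [_]; map; filter; foldr; length; allFin;
         cartesianProduct; cartesianProductWith; concatMap; upTo)
open import Data.List.Membership.Propositional as List∈ using ()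
open import Data.List.Membership.Propositional.Properties
  using (∈-allFin; ∈-++⁺ˡ; ∈-++⁺ʳ; ∈-map⁺; ∈-cartesianProductWith⁺;
         ∈-concatMap⁺; ∈-upTo⁺; ∈-lookup)
open import Data.List.Properties as List using ()
open import Data.List.Relation.Unary.All as All using (All)
open import Data.List.Relation.Unary.All.Properties as AllP using ()
open import Data.List.Relation.Unary.AllPairs as AllPairs using (AllPairs)
open import Data.List.Relation.Unary.Any as Any using (Any; here; there)
open import Data.List.Relation.Unary.Any.Properties using (lookup-index)
open import Data.List.Relation.Unary.Linked as Linked using (Linked)
open import Data.List.Relation.Unary.Unique.Propositional using (Unique)
open import Data.List.Relation.Unary.Unique.DecPropositional as DecUnique using ()
open import Data.Nat.Base as ℕ using (ℕ; zero; suc)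
open import Data.Nat.Properties as ℕ using ()
open import Data.Product.Base using (∃; _×_; _,_; proj₁; proj₂; uncurry)
open import Data.Product.Properties as Product using ()
open import Data.Sum.Base using (_⊎_; inj₁; inj₂)
open import Data.Vec.Base as Vec using (Vec; []; _∷_; _[_]≔_)
open import Data.Vec.Properties as Vec using ()
open import Induction.WellFounded using (WellFounded; Acc; acc; module Subrelation)
open import Level using (0ℓ)
open import Relation.Binary.Construct.Closure.ReflexiveTransitive using (Star; ε; _◅_; _◅◅_)
open import Relation.Binary.Construct.On as On using ()
open import Relation.Binary.Core using (Rel)
open import Relation.Binary.Definitions using (Decidable; DecidableEquality; Symmetric)
open import Relation.Binary.PropositionalEquality
  using (_≡_; refl; sym; trans; cong; subst)
open import Relation.Nullary.Decidable
  using (Dec; yes; no; does; map′; ¬?; _×-dec_; _⊎-dec_; _→-dec_)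
open import Relation.Nullary.Negation using (¬_)

private
  variable
    d : ℕ

-- A polynomial is a formal sum of terms (coefficient , exponent vector).
-- A monomial may occur in several terms, so the equality of ℤ[V] is
-- _≈_ below and not _≡_.

Monomial : ℕ → Set
Monomial d = Vec ℕ d

ℤ[_] : ℕ → Set
ℤ[ d ] = List (ℤ × Monomial d)

coeff : ℤ[ d ] → Monomial d → ℤ
coeff p m =
  foldr ℤ._+_ 0ℤ (map proj₁ (filter (λ t → Vec.≡-dec ℕ._≟_ (proj₂ t) m) p))

infix 4 _≈_

_≈_ : Rel ℤ[ d ] 0ℓ
p ≈ q = ∀ m → coeff p m ≡ coeff q m

const : ℤ → ℤ[ d ]
const c = [ (c , Vec.replicate _ 0) ]

var : Fin d → ℤ[ d ]
var v = [ (1ℤ , Vec.replicate _ 0 [ v ]≔ 1) ]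

infixl 6 _+_ _-_
infixl 7 _*_

_+_ : ℤ[ d ] → ℤ[ d ] → ℤ[ d ]
_+_ = _++_

_-_ : ℤ[ d ] → ℤ[ d ] → ℤ[ d ]
p - q = p + map (λ (c , m) → (ℤ.- c , m)) q

_*_ : ℤ[ d ] → ℤ[ d ] → ℤ[ d ]
_*_ = cartesianProductWith λ (c , m) (c′ , m′) → (c ℤ.* c′ , Vec.zipWith ℕ._+_ m m′)

∑ : List ℤ[ d ] → ℤ[ d ]
∑ = foldr _+_ (const 0ℤ)

∏ : List ℤ[ d ] → ℤ[ d ]
∏ = foldr _*_ (const 1ℤ)

-- A set of elements of a duplicate-free list xs is represented by the
-- sublist of xs consisting of its members; sublists xs lists each such
-- set exactly once.

sublists : ∀ {A : Set} → List A → List (List A)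
sublists []       = [ [] ]
sublists (x ∷ xs) = sublists xs ++ map (x ∷_) (sublists xs)

subsets : ∀ d → List (Subset d)
subsets zero    = [ [] ]
subsets (suc d) = map (outside ∷_) (subsets d) ++ map (inside ∷_) (subsets d)

∈-subsets : (B : Subset d) → B List∈.∈ subsets d
∈-subsets []            = here refl
∈-subsets (outside ∷ B) = ∈-++⁺ˡ (∈-map⁺ (outside ∷_) (∈-subsets B))
∈-subsets {suc d} (inside ∷ B) =
  ∈-++⁺ʳ (map (outside ∷_) (subsets d)) (∈-map⁺ (inside ∷_) (∈-subsets B))

module _ {R : Rel (Fin d) 0ℓ} (R? : Decidable R) where

  private
    -- walks all of whose intermediate vertices lie in the given list
    -- (Warshall's recursion)
    Via : List (Fin d) → Rel (Fin d) 0ℓ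
    Via []       u v = u ≡ v ⊎ R u v
    Via (x ∷ xs) u v = Via xs u v ⊎ (Via xs u x × Via xs x v)

    via? : ∀ xs → Decidable (Via xs)
    via? []       u v = (u Fin.≟ v) ⊎-dec R? u v
    via? (x ∷ xs) u v = via? xs u v ⊎-dec (via? xs u x ×-dec via? xs x v)

    via⇒star : ∀ xs {u v} → Via xs u v → Star R u v
    via⇒star []       (inj₁ refl)    = ε
    via⇒star []       (inj₂ r)       = r ◅ ε
    via⇒star (x ∷ xs) (inj₁ p)       = via⇒star xs p
    via⇒star (x ∷ xs) (inj₂ (p , q)) = via⇒star xs p ◅◅ via⇒star xs q

    via-base : ∀ xs {u v} → u ≡ v ⊎ R u v → Via xs u v
    via-base []       p = p
    via-base (x ∷ xs) p = inj₁ (via-base xs p)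

    via-join : ∀ {xs x u v} → x List∈.∈ xs → Via xs u x → Via xs x v → Via xs u v
    via-join {x ∷ xs} (here refl) p q = inj₂ (to p , from q)
      where
      to : ∀ {u} → Via (x ∷ xs) u x → Via xs u x
      to (inj₁ p)       = p
      to (inj₂ (p , _)) = p
      from : ∀ {v} → Via (x ∷ xs) x v → Via xs x v
      from (inj₁ q)       = q
      from (inj₂ (_ , q)) = q
    via-join (there i) (inj₁ p)       (inj₁ q)       = inj₁ (via-join i p q)
    via-join (there i) (inj₁ p)       (inj₂ (q , r)) = inj₂ (via-join i p q , r)
    via-join (there i) (inj₂ (p , q)) (inj₁ r)       = inj₂ (p , via-join i q r)
    via-join (there i) (inj₂ (p , _)) (inj₂ (_ , r)) = inj₂ (p , r)

    star⇒via : ∀ {u v} → Star R u v → Via (allFin d) u v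
    star⇒via ε       = via-base (allFin d) (inj₁ refl)
    star⇒via (r ◅ s) =
      via-join (∈-allFin _) (via-base (allFin d) (inj₂ r)) (star⇒via s)

  star? : Decidable (Star R)
  star? u v = map′ (via⇒star (allFin d)) star⇒via (via? (allFin d) u v)

record SimpleGraph (d : ℕ) : Set₁ where
  field
    Adj        : Rel (Fin d) 0ℓ
    adj?       : Decidable Adj
    adj-sym    : Symmetric Adj
    adj-irrefl : ∀ {v} → ¬ Adj v v

-- (u , v) is the edge uv directed from u to v.

Arcs : ℕ → Set
Arcs d = List (Fin d × Fin d)

_∈ₐ_ : Fin d × Fin d → Arcs d → Set
_∈ₐ_ = List∈._∈_

_∈ₐ?_ : Decidable (_∈ₐ_ {d})
a ∈ₐ? o = Any.any? (Product.≡-dec Fin._≟_ Fin._≟_ a) o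

-- A directed cycle v → v₁ → … → vₖ → v on distinct vertices, given by the
-- first vertex v and the list of the remaining ones.

DirectedCycle : Arcs d → Fin d → List (Fin d) → Set
DirectedCycle o v vs =
  Unique (v ∷ vs) × Linked (λ x y → (x , y) ∈ₐ o) (v ∷ vs ++ [ v ])

Acyclic : Arcs d → Set
Acyclic o = ∀ v vs → ¬ DirectedCycle o v vs

private
  words : ∀ d → ℕ → List (List (Fin d))
  words d zero    = [ [] ]
  words d (suc k) = cartesianProductWith _∷_ (allFin d) (words d k)

  ∈-words : (vs : List (Fin d)) → vs List∈.∈ words d (length vs)
  ∈-words []       = here refl
  ∈-words (v ∷ vs) = ∈-cartesianProductWith⁺ _∷_ (∈-allFin v) (∈-words vs)

  lookup-injective : ∀ {vs : List (Fin d)} → Unique vs → ∀ {i j} →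
                     List.lookup vs i ≡ List.lookup vs j → i ≡ j
  lookup-injective (_ AllPairs.∷ _)  {Fin.zero}  {Fin.zero}  _  = refl
  lookup-injective (v∉ AllPairs.∷ _) {Fin.zero}  {Fin.suc j} eq =
    ⊥-elim (All.lookup v∉ (∈-lookup j) eq)
  lookup-injective (v∉ AllPairs.∷ _) {Fin.suc i} {Fin.zero}  eq =
    ⊥-elim (All.lookup v∉ (∈-lookup i) (sym eq))
  lookup-injective (_ AllPairs.∷ u)  {Fin.suc i} {Fin.suc j} eq =
    cong Fin.suc (lookup-injective u eq)

  -- the vertices of a directed cycle are distinct, so at most d in number
  candidates : ∀ d → List (List (Fin d))
  candidates d = concatMap (words d) (upTo d)

  ∈-candidates : ∀ {v : Fin d} {vs} → Unique (v ∷ vs) → vs List∈.∈ candidates d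
  ∈-candidates {d = d} {v} {vs} u =
    ∈-concatMap⁺ (words d) (Any.map (λ { refl → ∈-words vs }) (∈-upTo⁺ bound))
    where
    bound : length (v ∷ vs) ℕ.≤ d
    bound = Fin.injective⇒≤ (lookup-injective u)

directedCycle? : ∀ (o : Arcs d) v vs → Dec (DirectedCycle o v vs)
directedCycle? o v vs =
  DecUnique.unique? Fin._≟_ (v ∷ vs)
    ×-dec Linked.linked? (λ x y → (x , y) ∈ₐ? o) (v ∷ vs ++ [ v ])

acyclic? : (o : Arcs d) → Dec (Acyclic o)
acyclic? {d} o = all? λ v →
  map′ (λ none vs c → All.lookup none (∈-candidates (proj₁ c)) c)
       (λ none → All.tabulate λ {vs} _ → none vs)
       (All.all? (λ vs → ¬? (directedCycle? o v vs)) (candidates d))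

module _ (G : SimpleGraph d) where
  open SimpleGraph G

  IsOrientation : Arcs d → Set
  IsOrientation o =
    All (uncurry Adj) o ×
    (∀ u v → Adj u v → ((u , v) ∈ₐ o × ¬ (v , u) ∈ₐ o)
                     ⊎ (¬ (u , v) ∈ₐ o × (v , u) ∈ₐ o))

  isOrientation? : ∀ o → Dec (IsOrientation o)
  isOrientation? o =
    All.all? (λ (u , v) → adj? u v) o ×-dec
    (all? λ u → all? λ v → adj? u v →-dec
      ((((u , v) ∈ₐ? o) ×-dec ¬? ((v , u) ∈ₐ? o))
         ⊎-dec (¬? ((u , v) ∈ₐ? o) ×-dec ((v , u) ∈ₐ? o))))

  acyclicOrientations : List (Arcs d)
  acyclicOrientations =
    filter (λ o → isOrientation? o ×-dec acyclic? o)
           (sublists (cartesianProduct (allFin d) (allFin d)))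

  IsSink : Arcs d → Fin d → Set
  IsSink o v = ∀ u → Adj u v → (u , v) ∈ₐ o

  isSink? : ∀ o v → Dec (IsSink o v)
  isSink? o v = all? λ u → adj? u v →-dec ((u , v) ∈ₐ? o)

  sinks : Arcs d → List (Fin d)
  sinks o = filter (isSink? o) (allFin d)

  acyclicOrientationPolynomial : ℤ[ d ]
  acyclicOrientationPolynomial =
    ∑ (map (λ o → ∏ (map var (sinks o))) acyclicOrientations)

Blocks : ℕ → Set
Blocks d = List (Subset d)

IsPartition : Blocks d → Set
IsPartition π = All Nonempty π × AllPairs (λ B C → Empty (B ∩ C)) π × ⋃ π ≡ ⊤

isPartition? : (π : Blocks d) → Dec (IsPartition π)
isPartition? π =
  All.all? nonempty? π
    ×-dec AllPairs.allPairs? (λ B C → ¬? (nonempty? (B ∩ C))) π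
    ×-dec Vec.≡-dec Bool._≟_ (⋃ π) ⊤

infix 4 _≤_ _≤?_ _<_ _<?_ _≟_

_≟_ : DecidableEquality (Blocks d)
_≟_ = List.≡-dec (Vec.≡-dec Bool._≟_)

_≤_ : Rel (Blocks d) 0ℓ
σ ≤ π = All (λ B → Any (B ⊆_) π) σ

_≤?_ : Decidable (_≤_ {d})
σ ≤? π = All.all? (λ B → Any.any? (B ⊆?_) π) σ

-- On vertex partitions refinement is antisymmetric, so this is the same as
-- σ ≤ π together with σ ≢ π; on arbitrary families of subsets, where it need
-- not be, this form is still well-founded.

_<_ : Rel (Blocks d) 0ℓ
σ < π = σ ≤ π × ¬ π ≤ σ

_<?_ : Decidable (_<_ {d})
σ <? π = (σ ≤? π) ×-dec ¬? (π ≤? σ)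

private
  Below : Blocks d → Subset d → Set
  Below π B = Any (B ⊆_) π

  below? : (π : Blocks d) (B : Subset d) → Dec (Below π B)
  below? π B = Any.any? (B ⊆?_) π

  below-mono : {σ π : Blocks d} → σ ≤ π → ∀ {B} → Below σ B → Below π B
  below-mono (C≤ All.∷ _)  {B} (here {x = C} B⊆C) =
    Any.map {P = C ⊆_} {Q = B ⊆_} (λ C⊆D {x} x∈B → C⊆D (B⊆C x∈B)) C≤
  below-mono (_ All.∷ σ≤π) (there i) = below-mono σ≤π i

  downset : Blocks d → Subset (length (subsets d))
  downset {d} π = Vec.tabulate λ i → does (below? π (List.lookup (subsets d) i))

  does⇒ : ∀ {P : Set} (P? : Dec P) → does P? ≡ inside → P
  does⇒ (yes p) _ = p

  ⇒does : ∀ {P : Set} (P? : Dec P) → P → does P? ≡ inside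
  ⇒does (yes _) _ = refl
  ⇒does (no ¬p) p = ⊥-elim (¬p p)

  ∈-downset⁺ : ∀ (π : Blocks d) i → Below π (List.lookup (subsets d) i) → i ∈ downset π
  ∈-downset⁺ π i b =
    Vec.lookup⇒[]= i (downset π)
      (trans (Vec.lookup∘tabulate _ i) (⇒does (below? π _) b))

  ∈-downset⁻ : ∀ (π : Blocks d) i → i ∈ downset π → Below π (List.lookup (subsets d) i)
  ∈-downset⁻ π i i∈ =
    does⇒ (below? π _)
      (trans (sym (Vec.lookup∘tabulate _ i)) (Vec.[]=⇒lookup i∈))

  new-block : ∀ {σ π : Blocks d} → ¬ π ≤ σ → ∃ λ B → B List∈.∈ π × ¬ Below σ B
  new-block {σ = σ} {π} π≰σ =
    List∈.find (AllP.¬All⇒Any¬ (below? σ) π π≰σ)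

  downset-⊂ : {σ π : Blocks d} → σ < π → downset σ ⊂ downset π
  downset-⊂ {σ = σ} {π} (σ≤π , π≰σ) with new-block {π = π} π≰σ
  ... | B , B∈π , B∉σ =
    (λ {i} i∈ → ∈-downset⁺ π i (below-mono σ≤π (∈-downset⁻ σ i i∈))) ,
    i ,
    ∈-downset⁺ π i (subst (Below π) B≡ (List∈.lose B∈π (⊆-refl {x = B}))) ,
    (λ i∈ → B∉σ (subst (Below σ) (sym B≡) (∈-downset⁻ σ i i∈)))
    where
    i  = Any.index (∈-subsets B)
    B≡ : B ≡ List.lookup (subsets _) i
    B≡ = lookup-index (∈-subsets B)

<-wellFounded : WellFounded (_<_ {d})
<-wellFounded =
  Subrelation.wellFounded downset-⊂ (On.wellFounded downset ⊂-wellFounded)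

module _ (G : SimpleGraph d) where
  open SimpleGraph G

  InducedAdj : Subset d → Rel (Fin d) 0ℓ
  InducedAdj B u v = u ∈ B × v ∈ B × Adj u v

  Connected : Subset d → Set
  Connected B = ∀ u v → u ∈ B → v ∈ B → Star (InducedAdj B) u v

  connected? : ∀ B → Dec (Connected B)
  connected? B = all? λ u → all? λ v → (u ∈? B) →-dec ((v ∈? B) →-dec
    star? (λ x y → (x ∈? B) ×-dec ((y ∈? B) ×-dec adj? x y)) u v)

  bonds : List (Blocks d)
  bonds = filter (λ π → isPartition? π ×-dec All.all? connected? π)
                 (sublists (subsets d))

  mutual
    μ-acc : (σ π : Blocks d) → Acc _<_ π → ℤ
    μ-acc σ π (acc rec) =
      if does (σ ≟ π) then 1ℤ else
      if does (σ <? π) then ℤ.- foldr ℤ._+_ 0ℤ (map (μ-summand σ π rec) bonds) else 0ℤ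

    -- μ(σ,τ) if σ ≤ τ < π, and 0 otherwise, so that summing it over all bonds τ
    -- gives the sum in the recursion defining μ(σ,π)
    μ-summand : (σ π : Blocks d) → (∀ {τ} → τ < π → Acc _<_ τ) → Blocks d → ℤ
    μ-summand σ π rec τ with σ ≤? τ | τ <? π
    ... | yes _ | yes τ<π = μ-acc σ τ (rec τ<π)
    ... | _     | _       = 0ℤ

  μ : Blocks d → Blocks d → ℤ
  μ σ π = μ-acc σ π (<-wellFounded π)

0̂ : Blocks d
0̂ {d} = filter (λ B → ∣ B ∣ ℕ.≟ 1) (subsets d)

blockPolynomial : Subset d → ℤ[ d ]
blockPolynomial B =
  const 1ℤ - ∏ (map (λ v → const 1ℤ - var v) (filter (_∈? B) (allFin _)))

{-# OPTIONS --safe #-}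

-- Set functions f : 2^V → R form an algebra under subset convolution ⋆, in which the sum
-- E w U = Σ_π ∏_{B ∈ π} w B over the set partitions π of U is an exponential:
-- E (w + w′) = E w ⋆ E w′.  Let i be the indicator of the independent sets of G and w = log i.
--
-- * Restricting i to the two sides of a disconnected set B shows that w B = 0, and restricting
--   it to the blocks of a bond π gives Σ_{τ ≤ π} ∏_{B ∈ τ} w B = ∏_{B ∈ π} i B = [π = 0̂].
--   Hence μ(0̂,π) = ∏_{B ∈ π} w B.
-- * With y_v = 1 - v, the weight (-1)^(|B|-1) w B (1 - ∏_{v ∈ B} y_v) is the sum of
--   -(-1)^|B| w B, whose exponential is the ⋆-inverse of (-1)^|T| i T, and of
--   ∏_{v ∈ B} (- y_v) w B, whose exponential is ∏_{v ∈ T} (- y_v) i T.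
-- * Making the vertices of an independent T ⊆ U sinks leaves an acyclic orientation of G[U ∖ T],
--   so i T a(U ∖ T), where a counts acyclic orientations, is the number of acyclic orientations
--   of G[U] all of whose vertices in T are sinks.  As a nonempty acyclic orientation has a sink,
--   a is the ⋆-inverse of (-1)^|T| i T, and convolving it with ∏_{v ∈ T} (- y_v) i T gives
--   Σ_o ∏_{v ∈ Sink o} (1 - y_v) = A_G.

module Submission where

open import Defs
  using (SimpleGraph; Arcs; _∈ₐ_; _∈ₐ?_; Acyclic; acyclic?; IsOrientation; isOrientation?;
         acyclicOrientations; IsSink; isSink?; sinks; sublists; subsets; ∈-subsets; star?;
         Blocks; IsPartition; isPartition?; _≟_; _≤_; _≤?_; _<_; _<?_; <-wellFounded;
         InducedAdj; Connected; connected?; bonds; μ-acc; μ-summand; μ; 0̂)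
open import Algebra.Bundles using (CommutativeRing)
open import Algebra.Morphism.Structures using (IsRingHomomorphism)
import Algebra.Properties.AbelianGroup as AbelianGroupProperties
import Algebra.Properties.CommutativeSemigroup as CommutativeSemigroupProperties
import Algebra.Properties.Ring as RingProperties
open import Data.Bool.Base using (true; false; if_then_else_)
open import Data.Fin.Base as Fin using (Fin)
open import Data.Fin.Properties as Fin using (all?; any?; ¬∀⟶∃¬)
open import Data.Fin.Subset
  using (Subset; inside; outside; _∈_; _⊆_; _∩_; _∪_; ∁; ⋃; ⊤; ⊥; ⁅_⁆; ∣_∣; Nonempty; Empty)
open import Data.Fin.Subset.Properties
  using (_∈?_; _⊆?_; nonempty?; Empty-unique; ∉⊥; ∈⊤; x∈p∪q⁺; x∈p∪q⁻; x∈p∩q⁺; x∈p∩q⁻;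
         p∩q⊆p; ⊆-antisym; ⊆-refl; drop-∷-⊆; x∈∁p⇒x∉p; x∉p⇒x∈∁p; x∈⁅x⁆; x∈⁅y⁆⇒x≡y;
         ∣⁅x⁆∣≡1; ∣⊤∣≡n; ∣⊥∣≡0)
open import Data.Integer.Base as ℤ using (ℤ; 0ℤ; 1ℤ; -1ℤ)
import Data.Integer.Properties as ℤ
open import Data.List.Base as List
  using (List; []; _∷_; [_]; _++_; foldr; map; filter; length; allFin; cartesianProduct)
open import Data.List.Membership.DecPropositional using () renaming (_∈?_ to member?)
open import Data.List.Membership.Propositional as List∈ using ()
open import Data.List.Membership.Propositional.Properties
  using (∈-filter⁺; ∈-filter⁻; ∈-++⁺ˡ; ∈-++⁺ʳ; ∈-++⁻; ∈-map⁺; ∈-map⁻; ∈-allFin; ∈-lookup;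
         ∈-cartesianProduct⁺)
open import Data.List.Membership.Propositional.Properties.WithK using (unique∧set⇒bag)
open import Data.List.Properties using (∷-injectiveʳ; filter-≐; length-map; length-++)
open import Data.List.Relation.Binary.BagAndSetEquality using (∼bag⇒↭)
open import Data.List.Relation.Binary.Permutation.Propositional.Properties using (↭-length)
open import Data.List.Relation.Unary.All as All using (All; []; _∷_)
open import Data.List.Relation.Unary.All.Properties using (¬All⇒Any¬)
open import Data.List.Relation.Unary.AllPairs as AllPairs using (AllPairs; []; _∷_)
open import Data.List.Relation.Unary.Any as Any using (Any; here; there)
open import Data.List.Relation.Unary.Linked as Linked using (Linked; []; [-]; _∷_)
open import Data.List.Relation.Unary.Unique.Propositional using (Unique)
import Data.List.Relation.Unary.Unique.Propositional.Properties as Unique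
open import Data.Nat.Base as ℕ using (ℕ; zero; suc; _∸_)
import Data.Nat.Properties as ℕ
open import Data.Product.Base using (∃; _×_; _,_; proj₁; proj₂; uncurry)
open import Data.Sum.Base using (_⊎_; inj₁; inj₂; [_,_]′)
open import Data.Vec.Base as Vec using (Vec; []; _∷_; here; there; lookup)
import Data.Vec.Properties as Vec
open import Function.Base using (_∘_; id)
open import Function.Bundles using (mk⇔)
open import Induction.WellFounded using (Acc; acc)
open import Level using (Level; 0ℓ)
open import Relation.Binary.Construct.Closure.ReflexiveTransitive using (Star; ε; _◅_; _◅◅_)
open import Relation.Binary.Core using (Rel)
open import Relation.Binary.PropositionalEquality as ≡ using (_≡_; _≢_)
import Relation.Binary.Reasoning.Setoid as SetoidReasoning
open import Relation.Nullary.Decidable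
  using (Dec; yes; no; does; ¬?; _×-dec_; _→-dec_; _⊎-dec_)
open import Relation.Nullary.Negation using (¬_; contradiction)
open import Relation.Unary using (Decidable)

-- Past the polynomial ring everything is proved over an arbitrary commutative ring, with a
-- homomorphism `ι` from ℤ and arbitrary values `x v` for the vertices: the laws of ℤ[V] hold only
-- up to `_≋_`, so the argument relies on ring axioms alone and never inspects terms. The obstacle
-- is that bonds, unlike arbitrary set partitions, have no evident recursion over the vertices. The
-- vanishing of `w` on disconnected sets removes it: partitions that are not bonds then contribute
-- nothing, and a sum over bonds becomes a value of `E`, which recurses on the first vertex. The
-- sign fits in because d - |π| is the sum of |B| - 1 over the blocks, so that it too is a product
-- over blocks. The product of `w` over the blocks is identified with `μ` by checking the recursion
-- that defines `μ`.

private
  variable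
    d : ℕ
    A : Set

-- The polynomial ring

module PolynomialRing (d : ℕ) where

  open Defs
  open ≡ using (refl; sym; trans; cong; cong₂; module ≡-Reasoning)
  open CommutativeSemigroupProperties ℤ.+-commutativeSemigroup
    renaming (interchange to ℤ-interchange) using ()

  -- The linear functional on ℤ[V] with value φ m at the monomial m.  Two formal sums
  -- are identified when no such functional separates them, which makes the ring laws
  -- instances of Fubini; coefficients are the functionals of Kronecker deltas.
  ⟨_⟩ : ℤ[ d ] → (Monomial d → ℤ) → ℤ
  ⟨ p ⟩ φ = foldr ℤ._+_ 0ℤ (map (λ t → proj₁ t ℤ.* φ (proj₂ t)) p)

  infix 4 _≋_
  -- A record instead of the bare function type, so that `p` and `q` can be recovered from a proof
  -- by unification.
  record _≋_ (p q : ℤ[ d ]) : Set where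
    constructor mk≋
    field ⟨⟩-≡ : ∀ φ → ⟨ p ⟩ φ ≡ ⟨ q ⟩ φ
  open _≋_

  ≋⇒≈ : ∀ {p q} → p ≋ q → p ≈ q
  ≋⇒≈ {p} {q} p≋q m = trans (coeff≡ p) (trans (⟨⟩-≡ p≋q δ) (sym (coeff≡ q)))
    where
    δ : Monomial d → ℤ
    δ m′ with Vec.≡-dec ℕ._≟_ m′ m
    ... | yes _ = 1ℤ
    ... | no _  = 0ℤ
    coeff≡ : ∀ p → coeff p m ≡ ⟨ p ⟩ δ
    coeff≡ []            = refl
    coeff≡ ((c , m′) ∷ p) with Vec.≡-dec ℕ._≟_ m′ m
    ... | yes _ = cong₂ ℤ._+_ (sym (ℤ.*-identityʳ c)) (coeff≡ p)
    ... | no _  = trans (coeff≡ p)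
                    (trans (sym (ℤ.+-identityˡ _)) (cong (ℤ._+ ⟨ p ⟩ δ) (sym (ℤ.*-zeroʳ c))))

  ⟨⟩-cong : ∀ p {φ ψ} → (∀ m → φ m ≡ ψ m) → ⟨ p ⟩ φ ≡ ⟨ p ⟩ ψ
  ⟨⟩-cong []            _   = refl
  ⟨⟩-cong ((c , m) ∷ p) φ≡ψ = cong₂ ℤ._+_ (cong (c ℤ.*_) (φ≡ψ m)) (⟨⟩-cong p φ≡ψ)

  ⟨++⟩ : ∀ p q φ → ⟨ p ++ q ⟩ φ ≡ ⟨ p ⟩ φ ℤ.+ ⟨ q ⟩ φ
  ⟨++⟩ []            q φ = sym (ℤ.+-identityˡ _)
  ⟨++⟩ ((c , m) ∷ p) q φ =
    trans (cong (ℤ._+_ (c ℤ.* φ m)) (⟨++⟩ p q φ)) (sym (ℤ.+-assoc (c ℤ.* φ m) _ _))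

  ⟨⟩-zero : ∀ p → ⟨ p ⟩ (λ _ → 0ℤ) ≡ 0ℤ
  ⟨⟩-zero []            = refl
  ⟨⟩-zero ((c , m) ∷ p) = cong₂ ℤ._+_ (ℤ.*-zeroʳ c) (⟨⟩-zero p)

  ⟨⟩-+ : ∀ p φ ψ → ⟨ p ⟩ (λ m → φ m ℤ.+ ψ m) ≡ ⟨ p ⟩ φ ℤ.+ ⟨ p ⟩ ψ
  ⟨⟩-+ []            φ ψ = refl
  ⟨⟩-+ ((c , m) ∷ p) φ ψ =
    trans (cong₂ ℤ._+_ (ℤ.*-distribˡ-+ c (φ m) (ψ m)) (⟨⟩-+ p φ ψ))
          (ℤ-interchange (c ℤ.* φ m) (c ℤ.* ψ m) _ _)

  ⟨⟩-*ˡ : ∀ p c φ → ⟨ p ⟩ (λ m → c ℤ.* φ m) ≡ c ℤ.* ⟨ p ⟩ φ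
  ⟨⟩-*ˡ []             c φ = sym (ℤ.*-zeroʳ c)
  ⟨⟩-*ˡ ((c′ , m) ∷ p) c φ = begin
    c′ ℤ.* (c ℤ.* φ m) ℤ.+ ⟨ p ⟩ (λ m → c ℤ.* φ m)
      ≡⟨ cong₂ ℤ._+_ (trans (sym (ℤ.*-assoc c′ c _))
                        (trans (cong (ℤ._* φ m) (ℤ.*-comm c′ c)) (ℤ.*-assoc c c′ _)))
                     (⟨⟩-*ˡ p c φ) ⟩
    c ℤ.* (c′ ℤ.* φ m) ℤ.+ c ℤ.* ⟨ p ⟩ φ
      ≡⟨ sym (ℤ.*-distribˡ-+ c _ _) ⟩
    c ℤ.* ⟨ (c′ , m) ∷ p ⟩ φ ∎
    where open ≡-Reasoning

  ⟨⟩-neg : ∀ p φ → ⟨ map (λ t → ℤ.- proj₁ t , proj₂ t) p ⟩ φ ≡ ℤ.- ⟨ p ⟩ φ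
  ⟨⟩-neg []            φ = refl
  ⟨⟩-neg ((c , m) ∷ p) φ =
    trans (cong₂ ℤ._+_ (sym (ℤ.neg-distribˡ-* c (φ m))) (⟨⟩-neg p φ))
          (sym (ℤ.neg-distrib-+ (c ℤ.* φ m) _))

  _·_ : Monomial d → Monomial d → Monomial d
  _·_ = Vec.zipWith ℕ._+_

  ·-identityˡ : ∀ m → Vec.replicate d 0 · m ≡ m
  ·-identityˡ = Vec.zipWith-identityˡ ℕ.+-identityˡ

  -- Turns a product into an iterated pairing along `_·_`: commutativity of `_*_` then comes from
  -- `⟨⟩-swap`, and associativity from that of adding exponent vectors.
  ⟨*⟩ : ∀ p q φ → ⟨ p * q ⟩ φ ≡ ⟨ p ⟩ (λ m → ⟨ q ⟩ (λ m′ → φ (m · m′)))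
  ⟨*⟩ []            q φ = refl
  ⟨*⟩ ((c , m) ∷ p) q φ =
    trans (⟨++⟩ (map _ q) (p * q) φ) (cong₂ ℤ._+_ (term q) (⟨*⟩ p q φ))
    where
    term : ∀ q → ⟨ map (λ t → c ℤ.* proj₁ t , m · proj₂ t) q ⟩ φ
               ≡ c ℤ.* ⟨ q ⟩ (λ m′ → φ (m · m′))
    term []              = sym (ℤ.*-zeroʳ c)
    term ((c′ , m′) ∷ q) =
      trans (cong₂ ℤ._+_ (ℤ.*-assoc c c′ _) (term q)) (sym (ℤ.*-distribˡ-+ c _ _))

  ⟨⟩-swap : ∀ p q (φ : Monomial d → Monomial d → ℤ) →
            ⟨ p ⟩ (λ m → ⟨ q ⟩ (φ m)) ≡ ⟨ q ⟩ (λ m′ → ⟨ p ⟩ (λ m → φ m m′))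
  ⟨⟩-swap []            q φ = sym (⟨⟩-zero q)
  ⟨⟩-swap ((c , m) ∷ p) q φ =
    trans (cong₂ ℤ._+_ (sym (⟨⟩-*ˡ q c (φ m))) (⟨⟩-swap p q φ))
          (sym (⟨⟩-+ q (λ m′ → c ℤ.* φ m m′) _))

  ⟨const⟩ : ∀ c φ → ⟨ const c ⟩ φ ≡ c ℤ.* φ (Vec.replicate d 0)
  ⟨const⟩ c φ = ℤ.+-identityʳ _

  private
    *-comm : ∀ p q → p * q ≋ q * p
    *-comm p q = mk≋ λ φ → begin
      ⟨ p * q ⟩ φ                                ≡⟨ ⟨*⟩ p q φ ⟩
      ⟨ p ⟩ (λ m → ⟨ q ⟩ (λ m′ → φ (m · m′)))    ≡⟨ ⟨⟩-swap p q _ ⟩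
      ⟨ q ⟩ (λ m′ → ⟨ p ⟩ (λ m → φ (m · m′)))
        ≡⟨ ⟨⟩-cong q (λ m′ → ⟨⟩-cong p (λ m → cong φ (Vec.zipWith-comm ℕ.+-comm m m′))) ⟩
      ⟨ q ⟩ (λ m′ → ⟨ p ⟩ (λ m → φ (m′ · m)))    ≡⟨ ⟨*⟩ q p φ ⟨
      ⟨ q * p ⟩ φ ∎
      where open ≡-Reasoning

    *-assoc : ∀ p q r → (p * q) * r ≋ p * (q * r)
    *-assoc p q r = mk≋ λ φ → begin
      ⟨ (p * q) * r ⟩ φ
        ≡⟨ trans (⟨*⟩ (p * q) r φ) (⟨*⟩ p q _) ⟩
      ⟨ p ⟩ (λ m → ⟨ q ⟩ (λ m′ → ⟨ r ⟩ (λ m″ → φ ((m · m′) · m″))))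
        ≡⟨ ⟨⟩-cong p (λ m → ⟨⟩-cong q (λ m′ → ⟨⟩-cong r (λ m″ →
             cong φ (Vec.zipWith-assoc ℕ.+-assoc m m′ m″)))) ⟩
      ⟨ p ⟩ (λ m → ⟨ q ⟩ (λ m′ → ⟨ r ⟩ (λ m″ → φ (m · (m′ · m″)))))
        ≡⟨ ⟨⟩-cong p (λ m → sym (⟨*⟩ q r _)) ⟩
      ⟨ p ⟩ (λ m → ⟨ q * r ⟩ (λ m′ → φ (m · m′)))
        ≡⟨ ⟨*⟩ p (q * r) φ ⟨
      ⟨ p * (q * r) ⟩ φ ∎
      where open ≡-Reasoning

    *-cong : ∀ {p p′ q q′} → p ≋ p′ → q ≋ q′ → p * q ≋ p′ * q′
    *-cong {p} {p′} {q} {q′} p≋ q≋ = mk≋ λ φ →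
      trans (⟨*⟩ p q φ) (trans (⟨⟩-cong p (λ m → ⟨⟩-≡ q≋ _))
        (trans (⟨⟩-≡ p≋ _) (sym (⟨*⟩ p′ q′ φ))))

    *-identityˡ : ∀ p → const 1ℤ * p ≋ p
    *-identityˡ p = mk≋ λ φ →
      trans (⟨*⟩ (const 1ℤ) p φ) (trans (⟨const⟩ 1ℤ λ m → ⟨ p ⟩ (λ m′ → φ (m · m′)))
        (trans (ℤ.*-identityˡ _) (⟨⟩-cong p (λ m → cong φ (·-identityˡ m)))))

    *-distribˡ : ∀ p q r → p * (q + r) ≋ p * q + p * r
    *-distribˡ p q r = mk≋ λ φ → begin
      ⟨ p * (q + r) ⟩ φ
        ≡⟨ trans (⟨*⟩ p (q + r) φ) (⟨⟩-cong p (λ m → ⟨++⟩ q r _)) ⟩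
      ⟨ p ⟩ (λ m → ⟨ q ⟩ (λ m′ → φ (m · m′)) ℤ.+ ⟨ r ⟩ (λ m′ → φ (m · m′)))
        ≡⟨ ⟨⟩-+ p _ _ ⟩
      ⟨ p ⟩ (λ m → ⟨ q ⟩ (λ m′ → φ (m · m′))) ℤ.+ ⟨ p ⟩ (λ m → ⟨ r ⟩ (λ m′ → φ (m · m′)))
        ≡⟨ cong₂ ℤ._+_ (⟨*⟩ p q φ) (⟨*⟩ p r φ) ⟨
      ⟨ p * q ⟩ φ ℤ.+ ⟨ p * r ⟩ φ
        ≡⟨ ⟨++⟩ (p * q) (p * r) φ ⟨
      ⟨ p * q + p * r ⟩ φ ∎
      where open ≡-Reasoning

    +-cong : ∀ {p p′ q q′} → p ≋ p′ → q ≋ q′ → p + q ≋ p′ + q′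
    +-cong {p} {p′} {q} {q′} p≋ q≋ = mk≋ λ φ →
      trans (⟨++⟩ p q φ) (trans (cong₂ ℤ._+_ (⟨⟩-≡ p≋ φ) (⟨⟩-≡ q≋ φ)) (sym (⟨++⟩ p′ q′ φ)))

    +-comm : ∀ p q → p + q ≋ q + p
    +-comm p q = mk≋ λ φ →
      trans (⟨++⟩ p q φ) (trans (ℤ.+-comm (⟨ p ⟩ φ) _) (sym (⟨++⟩ q p φ)))

    +-assoc : ∀ p q r → (p + q) + r ≋ p + (q + r)
    +-assoc p q r = mk≋ λ φ →
      trans (⟨++⟩ (p + q) r φ) (trans (cong (ℤ._+ ⟨ r ⟩ φ) (⟨++⟩ p q φ))
        (trans (ℤ.+-assoc (⟨ p ⟩ φ) _ _) (trans (cong (ℤ._+_ (⟨ p ⟩ φ)) (sym (⟨++⟩ q r φ)))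
          (sym (⟨++⟩ p (q + r) φ)))))

    +-identityˡ : ∀ p → const 0ℤ + p ≋ p
    -- `const 0ℤ` is not the empty list but one term with coefficient 0; its contribution computes
    -- to `0ℤ`.
    +-identityˡ p = mk≋ λ φ → ℤ.+-identityˡ _

    -‿inverseˡ : ∀ p → map (λ t → ℤ.- proj₁ t , proj₂ t) p + p ≋ const 0ℤ
    -‿inverseˡ p = mk≋ λ φ → trans (⟨++⟩ (map _ p) p φ)
      (trans (cong (ℤ._+ ⟨ p ⟩ φ) (⟨⟩-neg p φ)) (ℤ.+-inverseˡ (⟨ p ⟩ φ)))

    -‿cong : ∀ {p q} → p ≋ q →
             map (λ t → ℤ.- proj₁ t , proj₂ t) p ≋ map (λ t → ℤ.- proj₁ t , proj₂ t) q
    -‿cong {p} {q} p≋q = mk≋ λ φ →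
      trans (⟨⟩-neg p φ) (trans (cong ℤ.-_ (⟨⟩-≡ p≋q φ)) (sym (⟨⟩-neg q φ)))

    ≋-refl : ∀ {p} → p ≋ p
    ≋-refl = mk≋ λ _ → refl

    ≋-sym : ∀ {p q} → p ≋ q → q ≋ p
    ≋-sym p≋q = mk≋ λ φ → sym (⟨⟩-≡ p≋q φ)

    ≋-trans : ∀ {p q r} → p ≋ q → q ≋ r → p ≋ r
    ≋-trans p≋q q≋r = mk≋ λ φ → trans (⟨⟩-≡ p≋q φ) (⟨⟩-≡ q≋r φ)

  polynomialRing : CommutativeRing 0ℓ 0ℓ
  polynomialRing = record
    { Carrier = ℤ[ d ] ; _≈_ = _≋_ ; _+_ = _+_ ; _*_ = _*_
    ; -_ = map (λ t → ℤ.- proj₁ t , proj₂ t) ; 0# = const 0ℤ ; 1# = const 1ℤ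
    ; isCommutativeRing = record
      { isRing = record
        { +-isAbelianGroup = record
          { isGroup = record
            { isMonoid = record
              { isSemigroup = record
                { isMagma = record
                  { isEquivalence = record { refl = ≋-refl ; sym = ≋-sym ; trans = ≋-trans }
                  ; ∙-cong = +-cong }
                ; assoc = +-assoc }
              ; identity = +-identityˡ , λ p → ≋-trans (+-comm p (const 0ℤ)) (+-identityˡ p) }
            ; inverse = -‿inverseˡ , λ p → ≋-trans (+-comm p _) (-‿inverseˡ p)
            ; ⁻¹-cong = -‿cong }
          ; comm = +-comm }
        ; *-cong = *-cong
        ; *-assoc = *-assoc
        ; *-identity = *-identityˡ , λ p → ≋-trans (*-comm p (const 1ℤ)) (*-identityˡ p)
        ; distrib = *-distribˡ , λ p q r → ≋-trans (*-comm (q + r) p)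
            (≋-trans (*-distribˡ p q r) (+-cong (*-comm p q) (*-comm p r))) }
      ; *-comm = *-comm } }

  -- Signs and values of `μ` are integers; this map brings them into the ring where the general
  -- argument takes place.
  const-isRingHomomorphism :
    IsRingHomomorphism ℤ.+-*-rawRing (CommutativeRing.rawRing polynomialRing) const
  const-isRingHomomorphism = record
    { isSemiringHomomorphism = record
      { isNearSemiringHomomorphism = record
        { +-isMonoidHomomorphism = record
          { isMagmaHomomorphism = record
            { isRelHomomorphism = record { cong = λ { refl → ≋-refl } }
            ; homo = λ a b → mk≋ λ φ → trans (⟨const⟩ (a ℤ.+ b) φ)
                (trans (ℤ.*-distribʳ-+ _ a b) (cong (ℤ._+_ (a ℤ.* _)) (sym (⟨const⟩ b φ)))) }
          ; ε-homo = ≋-refl }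
        ; *-homo = λ a b → mk≋ λ φ → trans (⟨const⟩ (a ℤ.* b) φ)
            (trans (cong (λ m → a ℤ.* b ℤ.* φ m)
                         (sym (·-identityˡ (Vec.replicate d 0))))
                   (sym (ℤ.+-identityʳ _))) }
      ; 1#-homo = ≋-refl }
    ; -‿homo = λ a → ≋-refl }

-- Set functions under subset convolution

-- The decompositions U = T ⊔ S over which a convolution sums. There is one constructor for each
-- recursive branch of `∑split`, so that facts about single summands follow the same induction as
-- the sum.
data Split : ∀ {d} → Subset d → Subset d → Subset d → Set where
  []  : Split [] [] []
  out : ∀ {U T S : Subset d} → Split U T S → Split (outside ∷ U) (outside ∷ T) (outside ∷ S)
  inˡ : ∀ {U T S : Subset d} → Split U T S → Split (inside ∷ U) (inside ∷ T) (outside ∷ S)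
  inʳ : ∀ {U T S : Subset d} → Split U T S → Split (inside ∷ U) (outside ∷ T) (inside ∷ S)

split? : (U T : Subset d) → Dec (∃ (Split U T))
split? []            []            = yes ([] , [])
split? (outside ∷ U) (inside ∷ T)  = no λ { (_ , ()) }
split? (outside ∷ U) (outside ∷ T) with split? U T
... | yes (S , s) = yes (outside ∷ S , out s)
... | no ¬s       = no λ { (_ ∷ S , out s) → ¬s (S , s) }
split? (inside ∷ U)  (inside ∷ T)  with split? U T
... | yes (S , s) = yes (outside ∷ S , inˡ s)
... | no ¬s       = no λ { (_ ∷ S , inˡ s) → ¬s (S , s) }
split? (inside ∷ U)  (outside ∷ T) with split? U T
... | yes (S , s) = yes (inside ∷ S , inʳ s)
... | no ¬s       = no λ { (_ ∷ S , inʳ s) → ¬s (S , s) }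

-- Functions on the subsets of V under subset convolution form the algebra
-- R[eᵥ : v ∈ V] / (eᵥ²), where f stands for Σ_U f U ∏_{v ∈ U} eᵥ.
module SetFunctions {c ℓ : Level} (R : CommutativeRing c ℓ) where

  open CommutativeRing R
  open CommutativeSemigroupProperties +-commutativeSemigroup
    renaming (interchange to +-interchange) using ()
  open CommutativeSemigroupProperties *-commutativeSemigroup
    renaming (interchange to *-interchange; x∙yz≈y∙xz to x*yz≈y*xz) using ()
  open SetoidReasoning setoid

  -- Finite sums and products

  sum : ∀ {a} {A : Set a} → (A → Carrier) → List A → Carrier
  sum f xs = foldr _+_ 0# (map f xs)

  prod : ∀ {a} {A : Set a} → (A → Carrier) → List A → Carrier
  prod f xs = foldr _*_ 1# (map f xs)

  module _ {a} {A : Set a} where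

    sum-cong-∈ : {f g : A → Carrier} (xs : List A) → (∀ {x} → x List∈.∈ xs → f x ≈ g x) →
                 sum f xs ≈ sum g xs
    sum-cong-∈ []       _   = refl
    sum-cong-∈ (x ∷ xs) f≈g = +-cong (f≈g (here ≡.refl)) (sum-cong-∈ xs (f≈g ∘ there))

    sum-cong : {f g : A → Carrier} (xs : List A) → (∀ x → f x ≈ g x) → sum f xs ≈ sum g xs
    sum-cong xs f≈g = sum-cong-∈ xs (λ _ → f≈g _)

    sum-++ : ∀ (f : A → Carrier) xs ys → sum f (xs ++ ys) ≈ sum f xs + sum f ys
    sum-++ f []       ys = sym (+-identityˡ _)
    sum-++ f (x ∷ xs) ys = trans (+-congˡ (sum-++ f xs ys)) (sym (+-assoc _ _ _))

    sum-map : ∀ {b} {B : Set b} (f : A → Carrier) (g : B → A) xs →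
              sum f (map g xs) ≈ sum (f ∘ g) xs
    sum-map f g []       = refl
    sum-map f g (x ∷ xs) = +-congˡ (sum-map f g xs)

    sum-zero : ∀ {f : A → Carrier} xs → (∀ {x} → x List∈.∈ xs → f x ≈ 0#) → sum f xs ≈ 0#
    sum-zero []       _   = refl
    sum-zero (x ∷ xs) f≈0 =
      trans (+-cong (f≈0 (here ≡.refl)) (sum-zero xs (f≈0 ∘ there))) (+-identityˡ 0#)

    sum-+ : ∀ (f g : A → Carrier) xs → sum (λ x → f x + g x) xs ≈ sum f xs + sum g xs
    sum-+ f g []       = sym (+-identityˡ 0#)
    sum-+ f g (x ∷ xs) = trans (+-congˡ (sum-+ f g xs)) (+-interchange _ _ _ _)

    sum-*ˡ : ∀ c (f : A → Carrier) xs → sum (λ x → c * f x) xs ≈ c * sum f xs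
    sum-*ˡ c f []       = sym (zeroʳ c)
    sum-*ˡ c f (x ∷ xs) = trans (+-congˡ (sum-*ˡ c f xs)) (sym (distribˡ c _ _))

    sum-filter : ∀ {p} {P : A → Set p} (P? : Decidable P) {f g : A → Carrier} xs →
                 (∀ {x} → x List∈.∈ xs → P x → f x ≈ g x) →
                 (∀ {x} → x List∈.∈ xs → ¬ P x → g x ≈ 0#) →
                 sum f (filter P? xs) ≈ sum g xs
    sum-filter P? []       _   _   = refl
    sum-filter P? (x ∷ xs) f≈g g≈0 with P? x
    ... | yes p = +-cong (f≈g (here ≡.refl) p) (sum-filter P? xs (f≈g ∘ there) (g≈0 ∘ there))
    ... | no ¬p = trans (sum-filter P? xs (f≈g ∘ there) (g≈0 ∘ there))
                        (trans (sym (+-identityˡ _)) (+-congʳ (sym (g≈0 (here ≡.refl) ¬p))))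

    prod-cong : {f g : A → Carrier} {xs : List A} → All (λ x → f x ≈ g x) xs →
                prod f xs ≈ prod g xs
    prod-cong []            = refl
    prod-cong (fx≈gx ∷ f≈g) = *-cong fx≈gx (prod-cong f≈g)

    prod-* : ∀ (f g : A → Carrier) xs → prod (λ x → f x * g x) xs ≈ prod f xs * prod g xs
    prod-* f g []       = sym (*-identityˡ 1#)
    prod-* f g (x ∷ xs) = trans (*-congˡ (prod-* f g xs)) (*-interchange _ _ _ _)

    prod-one : {f : A → Carrier} {xs : List A} → All (λ x → f x ≈ 1#) xs → prod f xs ≈ 1#
    prod-one []           = refl
    prod-one (fx≈1 ∷ f≈1) = trans (*-cong fx≈1 (prod-one f≈1)) (*-identityˡ 1#)

    prod-zero : {f : A → Carrier} {xs : List A} → Any (λ x → f x ≈ 0#) xs → prod f xs ≈ 0#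
    prod-zero (here fx≈0) = trans (*-congʳ fx≈0) (zeroˡ _)
    prod-zero (there f≈0) = trans (*-congˡ (prod-zero f≈0)) (zeroʳ _)

  -- The convolution algebra

  SetFunction : ℕ → Set c
  SetFunction d = Subset d → Carrier

  infix 4 _≐_
  _≐_ : SetFunction d → SetFunction d → Set ℓ
  f ≐ g = ∀ U → f U ≈ g U

  infixl 6 _⊕_
  infixl 7 _⋆_
  infixr 8 _⊙_ _·_

  _⊕_ : SetFunction d → SetFunction d → SetFunction d
  (f ⊕ g) U = f U + g U

  _·_ : Carrier → SetFunction d → SetFunction d
  (a · f) U = a * f U

  𝟘 : SetFunction d
  𝟘 U = 0#

  -- With e the variable of the first vertex, f is `f ↾out` plus e times `f ↾in`: the value at e = 0
  -- and the derivative in e.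
  _↾out _↾in : SetFunction (suc d) → SetFunction d
  (f ↾out) U = f (outside ∷ U)
  (f ↾in)  U = f (inside ∷ U)

  -- Recursion on the first vertex makes the product rule hold by computation: `(f ⋆ g) ↾in` unfolds
  -- to `f ↾out ⋆ g ↾in ⊕ f ↾in ⋆ g ↾out`.
  ∑split : Subset d → (Subset d → Subset d → Carrier) → Carrier
  ∑split []            h = h [] []
  ∑split (outside ∷ U) h = ∑split U (λ T S → h (outside ∷ T) (outside ∷ S))
  ∑split (inside ∷ U)  h =
    ∑split U (λ T S → h (outside ∷ T) (inside ∷ S)) +
    ∑split U (λ T S → h (inside ∷ T) (outside ∷ S))

  _⋆_ : SetFunction d → SetFunction d → SetFunction d
  (f ⋆ g) U = ∑split U (λ T S → f T * g S)

  ∑split-cong : ∀ (U : Subset d) {h h′} → (∀ {T S} → Split U T S → h T S ≈ h′ T S) →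
                ∑split U h ≈ ∑split U h′
  ∑split-cong []            h≈ = h≈ []
  ∑split-cong (outside ∷ U) h≈ = ∑split-cong U (h≈ ∘ out)
  ∑split-cong (inside ∷ U)  h≈ = +-cong (∑split-cong U (h≈ ∘ inʳ)) (∑split-cong U (h≈ ∘ inˡ))

  ∑split-zero : ∀ (U : Subset d) {h} → (∀ {T S} → Split U T S → h T S ≈ 0#) → ∑split U h ≈ 0#
  ∑split-zero []            h≈0 = h≈0 []
  ∑split-zero (outside ∷ U) h≈0 = ∑split-zero U (h≈0 ∘ out)
  ∑split-zero (inside ∷ U)  h≈0 =
    trans (+-cong (∑split-zero U (h≈0 ∘ inʳ)) (∑split-zero U (h≈0 ∘ inˡ))) (+-identityˡ 0#)

  ∑split-+ : ∀ (U : Subset d) h h′ →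
             ∑split U (λ T S → h T S + h′ T S) ≈ ∑split U h + ∑split U h′
  ∑split-+ []            h h′ = refl
  ∑split-+ (outside ∷ U) h h′ = ∑split-+ U _ _
  ∑split-+ (inside ∷ U)  h h′ =
    trans (+-cong (∑split-+ U _ _) (∑split-+ U _ _)) (+-interchange _ _ _ _)

  ∑split-*ˡ : ∀ (U : Subset d) a h → ∑split U (λ T S → a * h T S) ≈ a * ∑split U h
  ∑split-*ˡ []            a h = refl
  ∑split-*ˡ (outside ∷ U) a h = ∑split-*ˡ U a _
  ∑split-*ˡ (inside ∷ U)  a h =
    trans (+-cong (∑split-*ˡ U a _) (∑split-*ˡ U a _)) (sym (distribˡ a _ _))

  ∑split-sum : ∀ {a} {A : Set a} (U : Subset d) (h : A → Subset d → Subset d → Carrier) xs →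
               ∑split U (λ T S → sum (λ x → h x T S) xs) ≈ sum (λ x → ∑split U (h x)) xs
  ∑split-sum U h []       = ∑split-zero U (λ _ → refl)
  ∑split-sum U h (x ∷ xs) = trans (∑split-+ U _ _) (+-congˡ (∑split-sum U h xs))

  ≐-sym : {f g : SetFunction d} → f ≐ g → g ≐ f
  ≐-sym f≐g U = sym (f≐g U)

  ≐-trans : {f g h : SetFunction d} → f ≐ g → g ≐ h → f ≐ h
  ≐-trans f≐g g≐h U = trans (f≐g U) (g≐h U)

  ⋆-cong : {f f′ g g′ : SetFunction d} → f ≐ f′ → g ≐ g′ → f ⋆ g ≐ f′ ⋆ g′
  ⋆-cong f≐ g≐ U = ∑split-cong U (λ _ → *-cong (f≐ _) (g≐ _))

  ⋆-congˡ : {f g g′ : SetFunction d} → g ≐ g′ → f ⋆ g ≐ f ⋆ g′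
  ⋆-congˡ g≐ = ⋆-cong (λ _ → refl) g≐

  ⋆-congʳ : {f f′ g : SetFunction d} → f ≐ f′ → f ⋆ g ≐ f′ ⋆ g
  ⋆-congʳ f≐ = ⋆-cong f≐ (λ _ → refl)

  ⋆-zeroˡ : ∀ {f : SetFunction d} g → f ≐ 𝟘 → f ⋆ g ≐ 𝟘
  ⋆-zeroˡ g f≐0 U = ∑split-zero U (λ _ → trans (*-congʳ (f≐0 _)) (zeroˡ _))

  ⋆-zeroʳ : ∀ (f : SetFunction d) {g} → g ≐ 𝟘 → f ⋆ g ≐ 𝟘
  ⋆-zeroʳ f g≐0 U = ∑split-zero U (λ _ → trans (*-congˡ (g≐0 _)) (zeroʳ _))

  ⋆-distribˡ : ∀ (f g h : SetFunction d) → f ⋆ (g ⊕ h) ≐ f ⋆ g ⊕ f ⋆ h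
  ⋆-distribˡ f g h U = trans (∑split-cong U (λ _ → distribˡ _ _ _)) (∑split-+ U _ _)

  ⋆-distribʳ : ∀ (f g h : SetFunction d) → (g ⊕ h) ⋆ f ≐ g ⋆ f ⊕ h ⋆ f
  ⋆-distribʳ f g h U = trans (∑split-cong U (λ _ → distribʳ _ _ _)) (∑split-+ U _ _)

  ⋆-·ʳ : ∀ (f : SetFunction d) a g → f ⋆ (a · g) ≐ a · (f ⋆ g)
  ⋆-·ʳ f a g U = trans (∑split-cong U (λ _ → x*yz≈y*xz _ _ _)) (∑split-*ˡ U a _)

  ⋆-·ˡ : ∀ a (f g : SetFunction d) → (a · f) ⋆ g ≐ a · (f ⋆ g)
  ⋆-·ˡ a f g U = trans (∑split-cong U (λ _ → *-assoc _ _ _)) (∑split-*ˡ U a _)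

  ⋆-sum : ∀ {a} {A : Set a} (f : SetFunction d) (g : A → SetFunction d) xs →
          f ⋆ (λ U → sum (λ x → g x U) xs) ≐ λ U → sum (λ x → (f ⋆ g x) U) xs
  ⋆-sum f g xs U =
    trans (∑split-cong U (λ _ → sym (sum-*ˡ _ _ xs))) (∑split-sum U _ xs)

  ⋆-comm : ∀ (f g : SetFunction d) → f ⋆ g ≐ g ⋆ f
  ⋆-comm f g []            = *-comm _ _
  ⋆-comm f g (outside ∷ U) = ⋆-comm (f ↾out) (g ↾out) U
  ⋆-comm f g (inside ∷ U)  =
    trans (+-comm _ _) (+-cong (⋆-comm (f ↾in) (g ↾out) U) (⋆-comm (f ↾out) (g ↾in) U))

  ⋆-assoc : ∀ (f g h : SetFunction d) → (f ⋆ g) ⋆ h ≐ f ⋆ (g ⋆ h)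
  ⋆-assoc f g h []            = *-assoc _ _ _
  ⋆-assoc f g h (outside ∷ U) = ⋆-assoc (f ↾out) (g ↾out) (h ↾out) U
  ⋆-assoc f g h (inside ∷ U)  = begin
    (f₀ ⋆ g₀ ⋆ h₁) U + ((f₀ ⋆ g₁ ⊕ f₁ ⋆ g₀) ⋆ h₀) U
      ≈⟨ +-cong (⋆-assoc f₀ g₀ h₁ U)
           (trans (⋆-distribʳ h₀ (f₀ ⋆ g₁) (f₁ ⋆ g₀) U)
                  (+-cong (⋆-assoc f₀ g₁ h₀ U) (⋆-assoc f₁ g₀ h₀ U))) ⟩
    (f₀ ⋆ (g₀ ⋆ h₁)) U + ((f₀ ⋆ (g₁ ⋆ h₀)) U + (f₁ ⋆ (g₀ ⋆ h₀)) U)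
      ≈⟨ +-assoc _ _ _ ⟨
    (f₀ ⋆ (g₀ ⋆ h₁)) U + (f₀ ⋆ (g₁ ⋆ h₀)) U + (f₁ ⋆ (g₀ ⋆ h₀)) U
      ≈⟨ +-congʳ (⋆-distribˡ f₀ (g₀ ⋆ h₁) (g₁ ⋆ h₀) U) ⟨
    (f₀ ⋆ (g₀ ⋆ h₁ ⊕ g₁ ⋆ h₀)) U + (f₁ ⋆ (g₀ ⋆ h₀)) U ∎
    where
    f₀ = f ↾out ; f₁ = f ↾in
    g₀ = g ↾out ; g₁ = g ↾in
    h₀ = h ↾out ; h₁ = h ↾in

  δ : SetFunction d
  δ []            = 1#
  δ (outside ∷ U) = δ U
  δ (inside ∷ U)  = 0#

  ⋆-identityˡ : ∀ (f : SetFunction d) → δ ⋆ f ≐ f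
  ⋆-identityˡ f []            = *-identityˡ _
  ⋆-identityˡ f (outside ∷ U) = ⋆-identityˡ (f ↾out) U
  ⋆-identityˡ f (inside ∷ U)  =
    trans (+-cong (⋆-identityˡ (f ↾in) U) (⋆-zeroˡ (f ↾out) (λ _ → refl) U)) (+-identityʳ _)

  ⋆-identityʳ : ∀ (f : SetFunction d) → f ⋆ δ ≐ f
  ⋆-identityʳ f = ≐-trans (⋆-comm f δ) (⋆-identityˡ f)

  ⋆-inverse-unique : ∀ (f g h : SetFunction d) → f ⋆ g ≐ δ → f ⋆ h ≐ δ → g ≐ h
  ⋆-inverse-unique f g h fg≐δ fh≐δ =
    ≐-trans (≐-sym (⋆-identityˡ g)) (≐-trans (⋆-congʳ {g = g} (≐-sym fh≐δ))
      (≐-trans (⋆-congʳ {g = g} (⋆-comm f h)) (≐-trans (⋆-assoc h f g)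
        (≐-trans (⋆-congˡ {f = h} fg≐δ) (⋆-identityʳ h)))))

  χ : (Fin d → Carrier) → SetFunction d
  χ t []            = 1#
  χ t (outside ∷ U) = χ (t ∘ Fin.suc) U
  χ t (inside ∷ U)  = t Fin.zero * χ (t ∘ Fin.suc) U

  -- The substitution of `t v` eᵥ for eᵥ, an endomorphism of the algebra; this is why it commutes
  -- with `_⋆_`, `δ` and `E`.
  _⊙_ : (Fin d → Carrier) → SetFunction d → SetFunction d
  (t ⊙ f) U = χ t U * f U

  χ-* : ∀ (t t′ : Fin d → Carrier) U → χ (λ v → t v * t′ v) U ≈ χ t U * χ t′ U
  χ-* t t′ []            = sym (*-identityˡ 1#)
  χ-* t t′ (outside ∷ U) = χ-* (t ∘ Fin.suc) (t′ ∘ Fin.suc) U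
  χ-* t t′ (inside ∷ U)  =
    trans (*-congˡ (χ-* (t ∘ Fin.suc) (t′ ∘ Fin.suc) U)) (*-interchange _ _ _ _)

  χ-split : ∀ (t : Fin d → Carrier) {U T S} → Split U T S → χ t U ≈ χ t T * χ t S
  χ-split t []      = sym (*-identityˡ 1#)
  χ-split t (out s) = χ-split (t ∘ Fin.suc) s
  χ-split t (inˡ s) = trans (*-congˡ (χ-split (t ∘ Fin.suc) s)) (sym (*-assoc _ _ _))
  χ-split t (inʳ s) = trans (*-congˡ (χ-split (t ∘ Fin.suc) s)) (x*yz≈y*xz _ _ _)

  ⊙-cong : ∀ (t : Fin d → Carrier) {f g} → f ≐ g → t ⊙ f ≐ t ⊙ g
  ⊙-cong t f≐g U = *-congˡ (f≐g U)

  ⊙-⋆ : ∀ (t : Fin d → Carrier) f g → (t ⊙ f) ⋆ (t ⊙ g) ≐ t ⊙ (f ⋆ g)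
  ⊙-⋆ t f g U = trans
    (∑split-cong U (λ s → trans (*-interchange _ _ _ _) (*-congʳ (sym (χ-split t s)))))
    (∑split-*ˡ U (χ t U) _)

  ⊙-δ : ∀ (t : Fin d → Carrier) → t ⊙ δ ≐ δ
  ⊙-δ t []            = *-identityˡ 1#
  ⊙-δ t (outside ∷ U) = ⊙-δ (t ∘ Fin.suc) U
  ⊙-δ t (inside ∷ U)  = zeroʳ _

  -- Exponential and logarithm

  -- E w U = Σ ∏_{B ∈ π} w B over the set partitions π of U; in the second clause the
  -- block containing the first element is split off.
  E : SetFunction d → SetFunction d
  E w []            = 1#
  E w (outside ∷ U) = E (w ↾out) U
  E w (inside ∷ U)  = (E (w ↾out) ⋆ w ↾in) U

  -- `E` never evaluates its argument at the empty set, so agreement on nonempty blocks suffices.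
  E-cong : {w w′ : SetFunction d} → (∀ B → Nonempty B → w B ≈ w′ B) → E w ≐ E w′
  E-cong w≈ []            = refl
  E-cong w≈ (outside ∷ U) = E-cong (λ { B (v , v∈B) → w≈ _ (Fin.suc v , there v∈B) }) U
  E-cong w≈ (inside ∷ U)  =
    ⋆-cong (E-cong (λ { B (v , v∈B) → w≈ _ (Fin.suc v , there v∈B) }))
           (λ B → w≈ _ (Fin.zero , here)) U

  E-zero : {w : SetFunction d} → (∀ B → Nonempty B → w B ≈ 0#) → E w ≐ δ
  E-zero w≈ []            = refl
  E-zero w≈ (outside ∷ U) = E-zero (λ { B (v , v∈B) → w≈ _ (Fin.suc v , there v∈B) }) U
  E-zero {w = w} w≈ (inside ∷ U)  = ⋆-zeroʳ (E (w ↾out)) (λ B → w≈ _ (Fin.zero , here)) U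

  -- Each block of a partition chooses between `f` and `g`. Formally this is the product rule: the
  -- derivative of `E f ⋆ E g` is E f₀ ⋆ (E g₀ ⋆ g₁) + (E f₀ ⋆ f₁) ⋆ E g₀, which by induction
  -- regroups to E (f₀ ⊕ g₀) ⋆ (f₁ ⊕ g₁).
  E-⊕ : ∀ (f g : SetFunction d) → E (f ⊕ g) ≐ E f ⋆ E g
  E-⊕ f g []            = sym (*-identityˡ 1#)
  E-⊕ f g (outside ∷ U) = E-⊕ (f ↾out) (g ↾out) U
  E-⊕ f g (inside ∷ U)  = begin
    (E (f₀ ⊕ g₀) ⋆ (f₁ ⊕ g₁)) U
      ≈⟨ ⋆-congʳ {g = f₁ ⊕ g₁} (E-⊕ f₀ g₀) U ⟩
    (E f₀ ⋆ E g₀ ⋆ (f₁ ⊕ g₁)) U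
      ≈⟨ ⋆-distribˡ (E f₀ ⋆ E g₀) f₁ g₁ U ⟩
    (E f₀ ⋆ E g₀ ⋆ f₁) U + (E f₀ ⋆ E g₀ ⋆ g₁) U
      ≈⟨ +-comm _ _ ⟩
    (E f₀ ⋆ E g₀ ⋆ g₁) U + (E f₀ ⋆ E g₀ ⋆ f₁) U
      ≈⟨ +-cong (⋆-assoc (E f₀) (E g₀) g₁ U)
           (trans (⋆-assoc (E f₀) (E g₀) f₁ U)
             (trans (⋆-congˡ {f = E f₀} (⋆-comm (E g₀) f₁) U)
               (sym (⋆-assoc (E f₀) f₁ (E g₀) U)))) ⟩
    (E f₀ ⋆ (E g₀ ⋆ g₁)) U + (E f₀ ⋆ f₁ ⋆ E g₀) U ∎
    where
    f₀ = f ↾out ; f₁ = f ↾in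
    g₀ = g ↾out ; g₁ = g ↾in

  neg : SetFunction d → SetFunction d
  neg f U = - f U

  E-inverse : ∀ (w : SetFunction d) → E w ⋆ E (neg w) ≐ δ
  E-inverse w = ≐-trans (≐-sym (E-⊕ w (neg w))) (E-zero (λ B _ → -‿inverseʳ (w B)))

  E-⊙ : ∀ (t : Fin d → Carrier) w → E (t ⊙ w) ≐ t ⊙ E w
  E-⊙ t w []            = sym (*-identityˡ 1#)
  E-⊙ t w (outside ∷ U) = E-⊙ (t ∘ Fin.suc) (w ↾out) U
  E-⊙ t w (inside ∷ U)  = begin
    (E (t′ ⊙ w₀) ⋆ (t ⊙ w) ↾in) U
      ≈⟨ ⋆-cong (E-⊙ t′ w₀) (λ B → trans (*-congʳ (*-comm _ _)) (*-assoc _ _ _)) U ⟩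
    ((t′ ⊙ E w₀) ⋆ (t′ ⊙ (t Fin.zero · w₁))) U
      ≈⟨ ⊙-⋆ t′ (E w₀) (t Fin.zero · w₁) U ⟩
    χ t′ U * (E w₀ ⋆ (t Fin.zero · w₁)) U
      ≈⟨ *-congˡ (⋆-·ʳ (E w₀) (t Fin.zero) w₁ U) ⟩
    χ t′ U * (t Fin.zero * (E w₀ ⋆ w₁) U)
      ≈⟨ trans (sym (*-assoc _ _ _)) (*-congʳ (*-comm _ _)) ⟩
    t Fin.zero * χ t′ U * (E w₀ ⋆ w₁) U ∎
    where
    t′ = t ∘ Fin.suc
    w₀ = w ↾out
    w₁ = w ↾in

  -- The derivative of `E w` is E w₀ ⋆ w₁ with E w₀ invertible, so w₁ is recovered by multiplying
  -- with `E (neg w₀)`, where w₀ is determined by induction.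
  E-injective : ∀ (w w′ : SetFunction d) → E w ≐ E w′ → ∀ B → Nonempty B → w B ≈ w′ B
  E-injective w w′ Ew≐ (outside ∷ B) (Fin.suc v , there v∈B) =
    E-injective (w ↾out) (w′ ↾out) (Ew≐ ∘ (outside ∷_)) B (v , v∈B)
  E-injective w w′ Ew≐ (inside ∷ B) _ = begin
    w₁ B                                 ≈⟨ cancel w₀ w₁ B ⟨
    (E (neg w₀) ⋆ (E w₀ ⋆ w₁)) B
      ≈⟨ ⋆-cong (E-cong (λ B B≠∅ → -‿cong (E-injective w₀ w₀′ (Ew≐ ∘ (outside ∷_)) B B≠∅)))
                (Ew≐ ∘ (inside ∷_)) B ⟩
    (E (neg w₀′) ⋆ (E w₀′ ⋆ w₁′)) B      ≈⟨ cancel w₀′ w₁′ B ⟩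
    w₁′ B ∎
    where
    w₀ = w ↾out ; w₀′ = w′ ↾out
    w₁ = w ↾in ; w₁′ = w′ ↾in
    cancel : ∀ f g → E (neg f) ⋆ (E f ⋆ g) ≐ g
    cancel f g = ≐-trans (≐-sym (⋆-assoc (E (neg f)) (E f) g))
      (≐-trans (⋆-congʳ {g = g} (≐-trans (⋆-comm (E (neg f)) (E f)) (E-inverse f)))
        (⋆-identityˡ g))

  -- Solves the recursion of `E` for `w ↾in`: a logarithmic derivative, in which
  -- `E (neg (Log (f ↾out)))` plays the part of 1/f. `E` leaves the value at the empty set free; it
  -- is set to `0#`, as `E-partitions` requires.
  Log : SetFunction d → SetFunction d
  Log f []            = 0#
  Log f (outside ∷ U) = Log (f ↾out) U
  Log f (inside ∷ U)  = (E (neg (Log (f ↾out))) ⋆ f ↾in) U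

  E-Log : ∀ (f : SetFunction d) → f ⊥ ≈ 1# → E (Log f) ≐ f
  E-Log f f⊥≈1 []            = sym f⊥≈1
  E-Log f f⊥≈1 (outside ∷ U) = E-Log (f ↾out) f⊥≈1 U
  E-Log f f⊥≈1 (inside ∷ U)  = begin
    (E w₀ ⋆ (E (neg w₀) ⋆ f ↾in)) U  ≈⟨ ⋆-assoc (E w₀) (E (neg w₀)) (f ↾in) U ⟨
    (E w₀ ⋆ E (neg w₀) ⋆ f ↾in) U    ≈⟨ ⋆-congʳ {g = f ↾in} (E-inverse w₀) U ⟩
    (δ ⋆ f ↾in) U                    ≈⟨ ⋆-identityˡ (f ↾in) U ⟩
    f (inside ∷ U) ∎
    where w₀ = Log (f ↾out)

  Log-⊥ : ∀ (f : SetFunction d) → Log f ⊥ ≈ 0#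
  Log-⊥ {zero}  f = refl
  Log-⊥ {suc d} f = Log-⊥ (f ↾out)

  -- The exponential as a sum over families of blocks

  single : Subset d → SetFunction d
  single []            []            = 1#
  single (outside ∷ B) (outside ∷ U) = single B U
  single (inside ∷ B)  (inside ∷ U)  = single B U
  single (outside ∷ B) (inside ∷ U)  = 0#
  single (inside ∷ B)  (outside ∷ U) = 0#

  sum-single : ∀ (g : SetFunction d) U → sum (λ B → g B * single B U) (subsets d) ≈ g U
  sum-single {zero}  g [] = trans (+-identityʳ _) (*-identityʳ _)
  sum-single {suc d} g (outside ∷ U) =
    trans (sum-++ _ (map (outside ∷_) (subsets d)) _)
      (trans (+-cong (trans (sum-map _ (outside ∷_) (subsets d)) (sum-single (g ↾out) U))
                     (trans (sum-map _ (inside ∷_) (subsets d))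
                            (sum-zero (subsets d) (λ _ → zeroʳ _))))
             (+-identityʳ _))
  sum-single {suc d} g (inside ∷ U) =
    trans (sum-++ _ (map (outside ∷_) (subsets d)) _)
      (trans (+-cong (trans (sum-map _ (outside ∷_) (subsets d))
                            (sum-zero (subsets d) (λ _ → zeroʳ _)))
                     (trans (sum-map _ (inside ∷_) (subsets d)) (sum-single (g ↾in) U)))
             (+-identityˡ _))

  single⋆-split : ∀ {U B S : Subset d} (f : SetFunction d) → Split U B S →
                  (single B ⋆ f) U ≈ f S
  single⋆-split f []      = *-identityˡ _
  single⋆-split f (out s) = single⋆-split (f ↾out) s
  single⋆-split f (inˡ {U = U} s) =
    trans (+-cong (⋆-zeroˡ (f ↾in) (λ _ → refl) U) (single⋆-split (f ↾out) s)) (+-identityˡ _)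
  single⋆-split f (inʳ {U = U} s) =
    trans (+-cong (single⋆-split (f ↾in) s) (⋆-zeroˡ (f ↾out) (λ _ → refl) U)) (+-identityʳ _)

  single⋆-unsplit : ∀ (f : SetFunction d) U B → ¬ ∃ (Split U B) → (single B ⋆ f) U ≈ 0#
  single⋆-unsplit f []            []            ¬s = contradiction ([] , []) ¬s
  single⋆-unsplit f (outside ∷ U) (outside ∷ B) ¬s =
    single⋆-unsplit (f ↾out) U B (λ { (S , s) → ¬s (_ , out s) })
  single⋆-unsplit f (outside ∷ U) (inside ∷ B)  ¬s = ⋆-zeroˡ (f ↾out) (λ _ → refl) U
  single⋆-unsplit f (inside ∷ U)  (outside ∷ B) ¬s =
    trans (+-cong (single⋆-unsplit (f ↾in) U B (λ { (S , s) → ¬s (_ , inʳ s) }))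
                  (⋆-zeroˡ (f ↾out) (λ _ → refl) U))
          (+-identityˡ 0#)
  single⋆-unsplit f (inside ∷ U)  (inside ∷ B)  ¬s =
    trans (+-cong (⋆-zeroˡ (f ↾in) (λ _ → refl) U)
                  (single⋆-unsplit (f ↾out) U B (λ { (S , s) → ¬s (_ , inˡ s) })))
          (+-identityˡ 0#)

  -- The product of 1 + `w B` e_B over the sets B in the list, where e_B = `single B` is the product
  -- of the eᵥ with v in B. As eᵥ² = 0, only families of pairwise disjoint sets survive its
  -- expansion.
  packings : SetFunction d → List (Subset d) → SetFunction d
  packings w []      = δ
  packings w (B ∷ L) = packings w L ⊕ w B · (single B ⋆ packings w L)

  packings-++ : ∀ (w : SetFunction d) L L′ →
                packings w (L ++ L′) ≐ packings w L ⋆ packings w L′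
  packings-++ w []      L′ = ≐-sym (⋆-identityˡ (packings w L′))
  packings-++ w (B ∷ L) L′ U = begin
    packings w (L ++ L′) U + w B * (single B ⋆ packings w (L ++ L′)) U
      ≈⟨ +-cong (packings-++ w L L′ U)
           (*-congˡ (trans (⋆-congˡ {f = single B} (packings-++ w L L′) U)
                           (sym (⋆-assoc (single B) P P′ U)))) ⟩
    (P ⋆ P′) U + w B * (single B ⋆ P ⋆ P′) U
      ≈⟨ +-congˡ (⋆-·ˡ (w B) (single B ⋆ P) P′ U) ⟨
    (P ⋆ P′) U + ((w B · (single B ⋆ P)) ⋆ P′) U
      ≈⟨ ⋆-distribʳ P′ P (w B · (single B ⋆ P)) U ⟨
    (packings w (B ∷ L) ⋆ P′) U ∎
    where
    P  = packings w L
    P′ = packings w L′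

  packings-outside-↾out : ∀ (w : SetFunction (suc d)) L →
    packings w (map (outside ∷_) L) ↾out ≐ packings (w ↾out) L
  packings-outside-↾out w []      U = refl
  packings-outside-↾out w (B ∷ L) U =
    +-cong (packings-outside-↾out w L U)
           (*-congˡ (⋆-congˡ {f = single B} (packings-outside-↾out w L) U))

  packings-outside-↾in : ∀ (w : SetFunction (suc d)) L →
    packings w (map (outside ∷_) L) ↾in ≐ 𝟘
  packings-outside-↾in w []      U = refl
  packings-outside-↾in w (B ∷ L) U = trans (+-cong (packings-outside-↾in w L U)
    (trans (*-congˡ (trans (+-cong (⋆-zeroʳ (single B) (packings-outside-↾in w L) U)
                                   (⋆-zeroˡ (packings w (map (outside ∷_) L) ↾out) (λ _ → refl) U))
                           (+-identityˡ 0#)))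
           (zeroʳ _)))
    (+-identityˡ 0#)

  packings-inside-↾out : ∀ (w : SetFunction (suc d)) L →
    packings w (map (inside ∷_) L) ↾out ≐ δ
  packings-inside-↾out w []      U = refl
  packings-inside-↾out w (B ∷ L) U = trans
    (+-cong (packings-inside-↾out w L U)
      (trans (*-congˡ (⋆-zeroˡ (packings w (map (inside ∷_) L) ↾out) (λ _ → refl) U)) (zeroʳ _)))
    (+-identityʳ _)

  -- Any two of these blocks share the first vertex and multiply to zero, so a surviving term that
  -- contains this vertex picks exactly one block.
  packings-inside-↾in : ∀ (w : SetFunction (suc d)) L →
    packings w (map (inside ∷_) L) ↾in ≐ λ U → sum (λ B → w (inside ∷ B) * single B U) L
  packings-inside-↾in w []      U = refl
  packings-inside-↾in w (B ∷ L) U = trans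
    (+-cong (packings-inside-↾in w L U)
      (*-congˡ (trans
        (+-cong (⋆-zeroˡ (packings w (map (inside ∷_) L) ↾in) (λ _ → refl) U)
                (trans (⋆-congˡ {f = single B} (packings-inside-↾out w L) U)
                       (⋆-identityʳ (single B) U)))
        (+-identityˡ _))))
    (+-comm _ _)

  -- For nonempty B, 1 + `w B` e_B is the exponential of `w B` e_B. The empty set is in the list as
  -- well and would contribute a factor 1 + `w ⊥`, whence the hypothesis. In the induction the sets
  -- without the first vertex give `E (w ↾out)`, and those with it contribute one block, as in the
  -- recursion of `E`.
  packings-subsets : ∀ (w : SetFunction d) → w ⊥ ≈ 0# → packings w (subsets d) ≐ E w
  packings-subsets {zero}  w w⊥≈0 [] =
    trans (+-congˡ (trans (*-congʳ w⊥≈0) (zeroˡ _))) (+-identityʳ 1#)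
  packings-subsets {suc d} w w⊥≈0 (outside ∷ U) = begin
    packings w (subsets (suc d)) (outside ∷ U)
      ≈⟨ packings-++ w (map (outside ∷_) (subsets d)) _ (outside ∷ U) ⟩
    (packings w (map (outside ∷_) (subsets d)) ↾out ⋆
     packings w (map (inside ∷_) (subsets d)) ↾out) U
      ≈⟨ ⋆-cong (packings-outside-↾out w (subsets d)) (packings-inside-↾out w (subsets d)) U ⟩
    (packings (w ↾out) (subsets d) ⋆ δ) U
      ≈⟨ ⋆-identityʳ (packings (w ↾out) (subsets d)) U ⟩
    packings (w ↾out) (subsets d) U
      ≈⟨ packings-subsets (w ↾out) w⊥≈0 U ⟩
    E (w ↾out) U ∎
  packings-subsets {suc d} w w⊥≈0 (inside ∷ U) = begin
    packings w (subsets (suc d)) (inside ∷ U)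
      ≈⟨ packings-++ w (map (outside ∷_) (subsets d)) _ (inside ∷ U) ⟩
    (O ↾out ⋆ I ↾in) U + (O ↾in ⋆ I ↾out) U
      ≈⟨ +-cong (⋆-cong (≐-trans (packings-outside-↾out w (subsets d))
                                 (packings-subsets (w ↾out) w⊥≈0))
                        (≐-trans (packings-inside-↾in w (subsets d)) (sum-single (w ↾in))) U)
                (⋆-zeroˡ (I ↾out) (packings-outside-↾in w (subsets d)) U) ⟩
    (E (w ↾out) ⋆ w ↾in) U + 0#
      ≈⟨ +-identityʳ _ ⟩
    (E (w ↾out) ⋆ w ↾in) U ∎
    where
    O = packings w (map (outside ∷_) (subsets d))
    I = packings w (map (inside ∷_) (subsets d))

  -- The product of the monomials e_B: its value at U is 1 if the blocks are disjoint with union U,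
  -- and 0 otherwise.
  tiling : Blocks d → SetFunction d
  tiling []      = δ
  tiling (B ∷ π) = single B ⋆ tiling π

  packings-sublists : ∀ (w : SetFunction d) L →
    packings w L ≐ λ U → sum (λ π → prod w π * tiling π U) (sublists L)
  packings-sublists w []      U = sym (trans (+-identityʳ _) (*-identityˡ _))
  packings-sublists w (B ∷ L) U = sym (begin
    sum (λ π → prod w π * tiling π U) (sublists L ++ map (B ∷_) (sublists L))
      ≈⟨ sum-++ _ (sublists L) _ ⟩
    sum (λ π → prod w π * tiling π U) (sublists L) +
    sum (λ π → prod w π * tiling π U) (map (B ∷_) (sublists L))
      ≈⟨ +-cong (sym (packings-sublists w L U)) (sum-map _ (B ∷_) (sublists L)) ⟩
    packings w L U + sum (λ π → w B * prod w π * (single B ⋆ tiling π) U) (sublists L)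
      ≈⟨ +-congˡ (trans (sum-cong (sublists L) (λ π → *-assoc _ _ _))
                        (sum-*ˡ (w B) _ (sublists L))) ⟩
    packings w L U + w B * sum (λ π → prod w π * (single B ⋆ tiling π) U) (sublists L)
      ≈⟨ +-congˡ (*-congˡ (sum-cong (sublists L)
           (λ π → sym (⋆-·ʳ (single B) (prod w π) (tiling π) U)))) ⟩
    packings w L U + w B * sum (λ π → (single B ⋆ (prod w π · tiling π)) U) (sublists L)
      ≈⟨ +-congˡ (*-congˡ (⋆-sum (single B) (λ π → prod w π · tiling π) (sublists L) U)) ⟨
    packings w L U + w B * (single B ⋆ (λ U → sum (λ π → prod w π * tiling π U) (sublists L))) U
      ≈⟨ +-congˡ (*-congˡ (⋆-congˡ {f = single B} (packings-sublists w L) U)) ⟨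
    packings w (B ∷ L) U ∎)

  E-partitions : ∀ (w : SetFunction d) → w ⊥ ≈ 0# →
    E w ≐ λ U → sum (λ π → prod w π * tiling π U) (sublists (subsets d))
  E-partitions w w⊥≈0 =
    ≐-trans (≐-sym (packings-subsets w w⊥≈0)) (packings-sublists w (subsets _))

-- Partitions and bonds

∈-sublists⇒∈ : ∀ {xs ys : List A} → ys List∈.∈ sublists xs → ∀ {y} → y List∈.∈ ys → y List∈.∈ xs
∈-sublists⇒∈ {xs = []}     (here ≡.refl) y∈ = y∈
∈-sublists⇒∈ {xs = x ∷ xs} ys∈ y∈ with ∈-++⁻ (sublists xs) ys∈
... | inj₁ ys∈′ = there (∈-sublists⇒∈ ys∈′ y∈)
... | inj₂ ys∈′ with ∈-map⁻ (x ∷_) ys∈′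
...   | zs , zs∈ , ≡.refl with y∈
...     | here ≡.refl = here ≡.refl
...     | there y∈′ = there (∈-sublists⇒∈ zs∈ y∈′)

filter-∈-sublists : ∀ {P : A → Set} (P? : Decidable P) xs → filter P? xs List∈.∈ sublists xs
filter-∈-sublists P? []       = here ≡.refl
filter-∈-sublists P? (x ∷ xs) with does (P? x)
... | true  = ∈-++⁺ʳ (sublists xs) (∈-map⁺ (x ∷_) (filter-∈-sublists P? xs))
... | false = ∈-++⁺ˡ (filter-∈-sublists P? xs)

head-∉ : ∀ {x : A} {xs} → Unique (x ∷ xs) → ¬ x List∈.∈ xs
head-∉ (x≢ ∷ _) x∈ = All.lookup x≢ x∈ ≡.refl

-- Sublists inherit the order of `xs`, so having the same members forces equality of lists. This is
-- how partitions and orientations, which are sets encoded as lists, are shown equal.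
sublists-ext : ∀ {xs : List A} → Unique xs → ∀ {ys zs} → ys List∈.∈ sublists xs →
               zs List∈.∈ sublists xs → (∀ {x} → x List∈.∈ ys → x List∈.∈ zs) →
               (∀ {x} → x List∈.∈ zs → x List∈.∈ ys) → ys ≡ zs
sublists-ext {xs = []}     _ (here ≡.refl) (here ≡.refl) _ _ = ≡.refl
sublists-ext {xs = x ∷ xs} xs! ys∈ zs∈ ys⊆zs zs⊆ys
  with ∈-++⁻ (sublists xs) ys∈ | ∈-++⁻ (sublists xs) zs∈
... | inj₁ ys∈′ | inj₁ zs∈′ = sublists-ext (AllPairs.tail xs!) ys∈′ zs∈′ ys⊆zs zs⊆ys
... | inj₁ ys∈′ | inj₂ zs∈′ with ∈-map⁻ (x ∷_) zs∈′
...   | zs′ , _ , ≡.refl = contradiction (∈-sublists⇒∈ ys∈′ (zs⊆ys (here ≡.refl))) (head-∉ xs!)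
sublists-ext {xs = x ∷ xs} xs! ys∈ zs∈ ys⊆zs zs⊆ys
    | inj₂ ys∈′ | inj₁ zs∈′ with ∈-map⁻ (x ∷_) ys∈′
...   | ys′ , _ , ≡.refl = contradiction (∈-sublists⇒∈ zs∈′ (ys⊆zs (here ≡.refl))) (head-∉ xs!)
sublists-ext {xs = x ∷ xs} xs! ys∈ zs∈ ys⊆zs zs⊆ys
    | inj₂ ys∈′ | inj₂ zs∈′ with ∈-map⁻ (x ∷_) ys∈′ | ∈-map⁻ (x ∷_) zs∈′
...   | ys′ , ys′∈ , ≡.refl | zs′ , zs′∈ , ≡.refl =
  ≡.cong (x ∷_) (sublists-ext (AllPairs.tail xs!) ys′∈ zs′∈
    (λ y∈ → tail∈ (∈-sublists⇒∈ ys′∈ y∈) (ys⊆zs (there y∈)))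
    (λ y∈ → tail∈ (∈-sublists⇒∈ zs′∈ y∈) (zs⊆ys (there y∈))))
  where
  tail∈ : ∀ {y ws} → y List∈.∈ xs → y List∈.∈ (x ∷ ws) → y List∈.∈ ws
  tail∈ y∈xs (here ≡.refl) = contradiction y∈xs (head-∉ xs!)
  tail∈ _    (there y∈)  = y∈

sublists-! : ∀ {xs : List A} → Unique xs → Unique (sublists xs)
sublists-! {xs = []}     _   = [] ∷ []
sublists-! {xs = x ∷ xs} xs! =
  Unique.++⁺ (sublists-! (AllPairs.tail xs!))
    (Unique.map⁺ ∷-injectiveʳ (sublists-! (AllPairs.tail xs!)))
    λ { (ys∈ , ys∈′) → disjoint ys∈ (∈-map⁻ (x ∷_) ys∈′) }
  where
  disjoint : ∀ {ys} → ys List∈.∈ sublists xs → ¬ (∃ λ zs → zs List∈.∈ sublists xs × ys ≡ x ∷ zs)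
  disjoint ys∈ (_ , _ , ≡.refl) = head-∉ xs! (∈-sublists⇒∈ ys∈ (here ≡.refl))

subsets-! : ∀ d → Unique (subsets d)
subsets-! zero    = [] ∷ []
subsets-! (suc d) =
  Unique.++⁺ (Unique.map⁺ Vec.∷-injectiveʳ (subsets-! d))
    (Unique.map⁺ Vec.∷-injectiveʳ (subsets-! d))
    λ { (B∈ , B∈′) → disjoint (∈-map⁻ (outside ∷_) B∈) (∈-map⁻ (inside ∷_) B∈′) }
  where
  disjoint : ∀ {B : Subset (suc d)} {P Q : Subset d → Set} →
             (∃ λ C → P C × B ≡ outside ∷ C) → ¬ (∃ λ C → Q C × B ≡ inside ∷ C)
  disjoint (_ , _ , ≡.refl) (_ , _ , ())

Split⇒⊆ˡ : ∀ {U T S : Subset d} → Split U T S → T ⊆ U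
Split⇒⊆ˡ (out s) (there v∈) = there (Split⇒⊆ˡ s v∈)
Split⇒⊆ˡ (inˡ s) here       = here
Split⇒⊆ˡ (inˡ s) (there v∈) = there (Split⇒⊆ˡ s v∈)
Split⇒⊆ˡ (inʳ s) (there v∈) = there (Split⇒⊆ˡ s v∈)

Split-sym : ∀ {U T S : Subset d} → Split U T S → Split U S T
Split-sym []      = []
Split-sym (out s) = out (Split-sym s)
Split-sym (inˡ s) = inʳ (Split-sym s)
Split-sym (inʳ s) = inˡ (Split-sym s)

Split⇒⊆ʳ : ∀ {U T S : Subset d} → Split U T S → S ⊆ U
Split⇒⊆ʳ = Split⇒⊆ˡ ∘ Split-sym

Split⇒disjoint : ∀ {U T S : Subset d} → Split U T S → ∀ {v} → v ∈ T → ¬ v ∈ S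
Split⇒disjoint (out s) (there v∈T) (there v∈S) = Split⇒disjoint s v∈T v∈S
Split⇒disjoint (inˡ s) (there v∈T) (there v∈S) = Split⇒disjoint s v∈T v∈S
Split⇒disjoint (inʳ s) (there v∈T) (there v∈S) = Split⇒disjoint s v∈T v∈S

Split⇒∪ : ∀ {U T S : Subset d} → Split U T S → T ∪ S ≡ U
Split⇒∪ []      = ≡.refl
Split⇒∪ (out s) = ≡.cong (outside ∷_) (Split⇒∪ s)
Split⇒∪ (inˡ s) = ≡.cong (inside ∷_) (Split⇒∪ s)
Split⇒∪ (inʳ s) = ≡.cong (inside ∷_) (Split⇒∪ s)

Split⇒∈ : ∀ {U T S : Subset d} → Split U T S → ∀ {v} → v ∈ U → v ∈ T ⊎ v ∈ S
Split⇒∈ s v∈U = x∈p∪q⁻ _ _ (≡.subst (_ ∈_) (≡.sym (Split⇒∪ s)) v∈U)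

disjoint⇒Split : (T S : Subset d) → (∀ {v} → v ∈ T → ¬ v ∈ S) → Split (T ∪ S) T S
disjoint⇒Split []            []            _ = []
disjoint⇒Split (outside ∷ T) (outside ∷ S) ∉ =
  out (disjoint⇒Split T S λ v∈T v∈S → ∉ (there v∈T) (there v∈S))
disjoint⇒Split (outside ∷ T) (inside ∷ S)  ∉ =
  inʳ (disjoint⇒Split T S λ v∈T v∈S → ∉ (there v∈T) (there v∈S))
disjoint⇒Split (inside ∷ T)  (outside ∷ S) ∉ =
  inˡ (disjoint⇒Split T S λ v∈T v∈S → ∉ (there v∈T) (there v∈S))
disjoint⇒Split (inside ∷ T)  (inside ∷ S)  ∉ = contradiction here (∉ here)

-- Unlike in a vertex partition, blocks may be empty.
data Tiles {d} : Blocks d → Subset d → Set where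
  []  : Tiles [] ⊥
  _∷_ : ∀ {B π U S} → Split U B S → Tiles π S → Tiles (B ∷ π) U

∈-⋃⁺ : ∀ {π : Blocks d} {B v} → B List∈.∈ π → v ∈ B → v ∈ ⋃ π
∈-⋃⁺ (here ≡.refl) v∈B = x∈p∪q⁺ (inj₁ v∈B)
∈-⋃⁺ (there B∈π) v∈B = x∈p∪q⁺ (inj₂ (∈-⋃⁺ B∈π v∈B))

∈-⋃⁻ : ∀ (π : Blocks d) {v} → v ∈ ⋃ π → ∃ λ B → B List∈.∈ π × v ∈ B
∈-⋃⁻ []      v∈ = contradiction v∈ ∉⊥
∈-⋃⁻ (B ∷ π) v∈ with x∈p∪q⁻ B (⋃ π) v∈
... | inj₁ v∈B = B , here ≡.refl , v∈B
... | inj₂ v∈⋃ with ∈-⋃⁻ π v∈⋃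
...   | C , C∈π , v∈C = C , there C∈π , v∈C

Tiles⇒⋃ : ∀ {π : Blocks d} {U} → Tiles π U → ⋃ π ≡ U
Tiles⇒⋃ []      = ≡.refl
Tiles⇒⋃ {π = B ∷ _} (s ∷ t) = ≡.trans (≡.cong (B ∪_) (Tiles⇒⋃ t)) (Split⇒∪ s)

Tiles⇒disjoint : ∀ {π : Blocks d} {U} → Tiles π U → AllPairs (λ B C → Empty (B ∩ C)) π
Tiles⇒disjoint []      = []
Tiles⇒disjoint (s ∷ t) = All.tabulate disjoint ∷ Tiles⇒disjoint t
  where
  disjoint : ∀ {C} → C List∈.∈ _ → Empty (_ ∩ C)
  disjoint {C} C∈π (v , v∈) with x∈p∩q⁻ _ C v∈
  ... | v∈B , v∈C =
    Split⇒disjoint s v∈B (≡.subst (v ∈_) (Tiles⇒⋃ t) (∈-⋃⁺ C∈π v∈C))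

disjoint⇒Tiles : ∀ {π : Blocks d} → AllPairs (λ B C → Empty (B ∩ C)) π → Tiles π (⋃ π)
disjoint⇒Tiles {π = []}    []       = []
disjoint⇒Tiles {π = B ∷ π} (B# ∷ π#) = disjoint⇒Split B (⋃ π) disjoint ∷ disjoint⇒Tiles π#
  where
  disjoint : ∀ {v} → v ∈ B → ¬ v ∈ ⋃ π
  disjoint v∈B v∈⋃ with ∈-⋃⁻ π v∈⋃
  ... | C , C∈π , v∈C = All.lookup B# C∈π (_ , x∈p∩q⁺ (v∈B , v∈C))

IsPartition⇒Tiles : ∀ {π : Blocks d} → IsPartition π → Tiles π ⊤
IsPartition⇒Tiles (_ , π# , ⋃π≡⊤) = ≡.subst (Tiles _) ⋃π≡⊤ (disjoint⇒Tiles π#)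

Tiles⇒IsPartition : ∀ {π : Blocks d} → All Nonempty π → Tiles π ⊤ → IsPartition π
Tiles⇒IsPartition π≠∅ t = π≠∅ , Tiles⇒disjoint t , Tiles⇒⋃ t

covering-block : ∀ {π : Blocks d} → IsPartition π → ∀ v → ∃ λ B → B List∈.∈ π × v ∈ B
covering-block {π = π} (_ , _ , ⋃π≡⊤) v = ∈-⋃⁻ π (≡.subst (v ∈_) (≡.sym ⋃π≡⊤) ∈⊤)

same-block : ∀ {π : Blocks d} → AllPairs (λ B C → Empty (B ∩ C)) π →
             ∀ {B C v} → B List∈.∈ π → C List∈.∈ π → v ∈ B → v ∈ C → B ≡ C
same-block _         (here ≡.refl) (here ≡.refl) _   _   = ≡.refl
same-block (B# ∷ _)  (here ≡.refl) (there C∈)  v∈B v∈C =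
  contradiction (_ , x∈p∩q⁺ (v∈B , v∈C)) (All.lookup B# C∈)
same-block (C# ∷ _)  (there B∈)  (here ≡.refl) v∈B v∈C =
  contradiction (_ , x∈p∩q⁺ (v∈C , v∈B)) (All.lookup C# B∈)
same-block (_ ∷ π#)  (there B∈)  (there C∈)  v∈B v∈C = same-block π# B∈ C∈ v∈B v∈C

-- A block B of σ lies in some C of π, which lies in some B′ of σ. As B is nonempty, B and B′ share
-- a vertex and hence coincide, so B = C.
partition-antisym : ∀ {σ π : Blocks d} → σ List∈.∈ sublists (subsets d) → IsPartition σ →
                    π List∈.∈ sublists (subsets d) → IsPartition π →
                    σ Defs.≤ π → π Defs.≤ σ → σ ≡ π
partition-antisym {d} {σ} {π} σ∈ σ-part π∈ π-part σ≤π π≤σ =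
  sublists-ext (subsets-! d) σ∈ π∈ (⊆-blocks σ-part σ≤π π≤σ) (⊆-blocks π-part π≤σ σ≤π)
  where
  ⊆-blocks : ∀ {σ π : Blocks d} → IsPartition σ → σ Defs.≤ π → π Defs.≤ σ →
             ∀ {B} → B List∈.∈ σ → B List∈.∈ π
  ⊆-blocks (σ≠∅ , σ# , _) σ≤π π≤σ {B} B∈σ
    with List∈.find (All.lookup σ≤π B∈σ)
  ... | C , C∈π , B⊆C with List∈.find (All.lookup π≤σ C∈π) | All.lookup σ≠∅ B∈σ
  ...   | B′ , B′∈σ , C⊆B′ | v , v∈B with same-block σ# B∈σ B′∈σ v∈B (C⊆B′ (B⊆C v∈B))
  ...     | ≡.refl = ≡.subst (List∈._∈ _) (⊆-antisym C⊆B′ B⊆C) C∈π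

Split-∩ : ∀ (U P : Subset d) → Split U (U ∩ P) (U ∩ ∁ P)
Split-∩ []            []            = []
Split-∩ (outside ∷ U) (_ ∷ P)       = out (Split-∩ U P)
Split-∩ (inside ∷ U)  (inside ∷ P)  = inˡ (Split-∩ U P)
Split-∩ (inside ∷ U)  (outside ∷ P) = inʳ (Split-∩ U P)

Split⇒∩ : ∀ {U T S : Subset d} → Split U T S → U ∩ T ≡ T
Split⇒∩ []      = ≡.refl
Split⇒∩ (out s) = ≡.cong (outside ∷_) (Split⇒∩ s)
Split⇒∩ (inˡ s) = ≡.cong (inside ∷_) (Split⇒∩ s)
Split⇒∩ (inʳ s) = ≡.cong (outside ∷_) (Split⇒∩ s)

setOf : {P : Fin d → Set} → Decidable P → Subset d
setOf P? = Vec.tabulate (does ∘ P?)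

∈-setOf⁺ : ∀ {P : Fin d → Set} (P? : Decidable P) {v} → P v → v ∈ setOf P?
∈-setOf⁺ P? {v} p = Vec.lookup⇒[]= v _ (≡.trans (Vec.lookup∘tabulate _ v) does≡)
  where
  does≡ : does (P? v) ≡ inside
  does≡ with P? v
  ... | yes _ = ≡.refl
  ... | no ¬p = contradiction p ¬p

∈-setOf⁻ : ∀ {P : Fin d → Set} (P? : Decidable P) {v} → v ∈ setOf P? → P v
∈-setOf⁻ P? {v} v∈
  with P? v | ≡.trans (≡.sym (Vec.lookup∘tabulate (does ∘ P?) v)) (Vec.[]=⇒lookup v∈)
... | yes p | _ = p

singleton⇒≡⁅⁆ : ∀ (B : Subset d) → ∣ B ∣ ≡ 1 → ∃ λ v → B ≡ ⁅ v ⁆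
singleton⇒≡⁅⁆ (outside ∷ B) ∣B∣≡1 with singleton⇒≡⁅⁆ B ∣B∣≡1
... | v , ≡.refl = Fin.suc v , ≡.refl
singleton⇒≡⁅⁆ (inside ∷ B)  ∣B∣≡1 =
  Fin.zero , ≡.cong (inside ∷_) (Empty-unique (∣p∣≡0⇒Empty B (ℕ.suc-injective ∣B∣≡1)))
  where
  ∣p∣≡0⇒Empty : ∀ {n} (p : Subset n) → ∣ p ∣ ≡ 0 → Empty p
  ∣p∣≡0⇒Empty (outside ∷ p) ∣p∣≡0 (_ , there v∈p) = ∣p∣≡0⇒Empty p ∣p∣≡0 (_ , v∈p)

⁅⁆∈0̂ : ∀ (v : Fin d) → ⁅ v ⁆ List∈.∈ 0̂
⁅⁆∈0̂ v = ∈-filter⁺ (λ B → ∣ B ∣ ℕ.≟ 1) (∈-subsets ⁅ v ⁆) (∣⁅x⁆∣≡1 v)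

∈0̂⇒≡⁅⁆ : ∀ {B : Subset d} → B List∈.∈ 0̂ → ∃ λ v → B ≡ ⁅ v ⁆
∈0̂⇒≡⁅⁆ {d} B∈ = singleton⇒≡⁅⁆ _ (proj₂ (∈-filter⁻ (λ B → ∣ B ∣ ℕ.≟ 1) {xs = subsets d} B∈))

∈0̂⇒≡ : ∀ {B : Subset d} {u v} → B List∈.∈ 0̂ → u ∈ B → v ∈ B → u ≡ v
∈0̂⇒≡ B∈ u∈B v∈B with ∈0̂⇒≡⁅⁆ B∈
... | x , ≡.refl = ≡.trans (x∈⁅y⁆⇒x≡y x u∈B) (≡.sym (x∈⁅y⁆⇒x≡y x v∈B))

0̂-isPartition : IsPartition (0̂ {d})
0̂-isPartition {d} =
  All.tabulate (λ B∈ → nonempty (∈0̂⇒≡⁅⁆ B∈)) ,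
  disjoint id (Unique.filter⁺ (λ B → ∣ B ∣ ℕ.≟ 1) (subsets-! d)) ,
  ⊆-antisym (λ _ → ∈⊤) (λ {v} _ → ∈-⋃⁺ (⁅⁆∈0̂ v) (x∈⁅x⁆ v))
  where
  nonempty : ∀ {B : Subset d} → (∃ λ v → B ≡ ⁅ v ⁆) → Nonempty B
  nonempty (v , ≡.refl) = v , x∈⁅x⁆ v
  disjoint : ∀ {π : Blocks d} → (∀ {B} → B List∈.∈ π → B List∈.∈ 0̂) → Unique π →
             AllPairs (λ B C → Empty (B ∩ C)) π
  disjoint π⊆0̂ []         = []
  disjoint {B ∷ π} π⊆0̂ (B∉ ∷ π!) = All.tabulate B# ∷ disjoint (π⊆0̂ ∘ there) π!
    where
    B# : ∀ {C} → C List∈.∈ π → Empty (B ∩ C)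
    B# {C} C∈ (v , v∈) with x∈p∩q⁻ B C v∈ | ∈0̂⇒≡⁅⁆ (π⊆0̂ (here ≡.refl)) | ∈0̂⇒≡⁅⁆ (π⊆0̂ (there C∈))
    ... | v∈B , v∈C | x , ≡.refl | y , ≡.refl =
      All.lookup B∉ C∈ (≡.cong ⁅_⁆ (≡.trans (≡.sym (x∈⁅y⁆⇒x≡y x v∈B)) (x∈⁅y⁆⇒x≡y y v∈C)))

0̂-minimum : ∀ {π : Blocks d} → IsPartition π → 0̂ ≤ π
0̂-minimum π-part = All.tabulate below
  where
  below : ∀ {B} → B List∈.∈ 0̂ → Any (B ⊆_) _
  below B∈ with ∈0̂⇒≡⁅⁆ B∈
  ... | v , ≡.refl with covering-block π-part v
  ...   | C , C∈π , v∈C =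
    List∈.lose C∈π (λ u∈ → ≡.subst (_∈ C) (≡.sym (x∈⁅y⁆⇒x≡y v u∈)) v∈C)

≤-refl : ∀ {π : Blocks d} → π ≤ π
≤-refl {π = π} = All.tabulate (λ {B} B∈π → List∈.lose B∈π (⊆-refl {x = B}))

-- Independent sets, bonds and connectivity

module _ (G : SimpleGraph d) where
  open SimpleGraph G

  Independent : Subset d → Set
  Independent T = ∀ u v → u ∈ T → v ∈ T → ¬ Adj u v

  independent? : Decidable Independent
  independent? T = all? λ u → all? λ v → (u ∈? T) →-dec ((v ∈? T) →-dec ¬? (adj? u v))

  ∈-bonds⁻ : ∀ {π} → π List∈.∈ bonds G →
             π List∈.∈ sublists (subsets d) × IsPartition π × All (Connected G) π
  ∈-bonds⁻ π∈ = ∈-filter⁻ (λ π → isPartition? π ×-dec All.all? (connected? G) π)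
                          {xs = sublists (subsets d)} π∈

  0̂∈bonds : 0̂ List∈.∈ bonds G
  0̂∈bonds = ∈-filter⁺ (λ π → isPartition? π ×-dec All.all? (connected? G) π)
    (filter-∈-sublists (λ B → ∣ B ∣ ℕ.≟ 1) (subsets d))
    (0̂-isPartition , All.tabulate λ B∈ u v u∈ v∈ →
      ≡.subst (Star _ u) (∈0̂⇒≡ B∈ u∈ v∈) ε)

  bonds-! : Unique (bonds G)
  bonds-! = Unique.filter⁺ (λ π → isPartition? π ×-dec All.all? (connected? G) π)
                           (sublists-! (subsets-! d))

  bonds-antisym : ∀ {σ π} → σ List∈.∈ bonds G → π List∈.∈ bonds G → σ ≤ π → π ≤ σ → σ ≡ π
  bonds-antisym σ∈ π∈ = partition-antisym (proj₁ (∈-bonds⁻ σ∈)) (proj₁ (proj₂ (∈-bonds⁻ σ∈)))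
                                          (proj₁ (∈-bonds⁻ π∈)) (proj₁ (proj₂ (∈-bonds⁻ π∈)))

  -- A walk inside `B` with at least one step would use an edge of `B`, so connectivity leaves no
  -- room for a second vertex.
  connected-independent⇒singleton : ∀ {B v} → v ∈ B → Connected G B → Independent B → B ≡ ⁅ v ⁆
  connected-independent⇒singleton {B} {v} v∈B conn indep = ⊆-antisym to from
    where
    trivial : ∀ {u} → Star (InducedAdj G B) v u → u ≡ v
    trivial ε                         = ≡.refl
    trivial ((v∈B , w∈B , v~w) ◅ _) = contradiction v~w (indep _ _ v∈B w∈B)
    to : B ⊆ ⁅ v ⁆
    to u∈B = ≡.subst (_∈ ⁅ v ⁆) (≡.sym (trivial (conn _ _ v∈B u∈B))) (x∈⁅x⁆ v)
    from : ⁅ v ⁆ ⊆ B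
    from u∈ = ≡.subst (_∈ B) (≡.sym (x∈⁅y⁆⇒x≡y v u∈)) v∈B

  independent-bond⇒0̂ : ∀ {π} → π List∈.∈ bonds G → All Independent π → 0̂ ≡ π
  independent-bond⇒0̂ {π} π∈ π-indep with ∈-bonds⁻ π∈
  ... | _ , π-part@(π≠∅ , _) , π-conn =
    bonds-antisym 0̂∈bonds π∈ (0̂-minimum π-part) (All.tabulate below)
    where
    below : ∀ {B} → B List∈.∈ π → Any (B ⊆_) 0̂
    below B∈ with All.lookup π≠∅ B∈
    ... | v , v∈B = List∈.lose (⁅⁆∈0̂ v) λ {x} x∈B → ≡.subst (x ∈_)
      (connected-independent⇒singleton v∈B (All.lookup π-conn B∈) (All.lookup π-indep B∈)) x∈B

  reachable? : ∀ B u v → Dec (Star (InducedAdj G B) u v)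
  reachable? B = star? (λ x y → (x ∈? B) ×-dec ((y ∈? B) ×-dec adj? x y))

  -- A disconnected set splits off the component of one of its vertices.
  disconnected⇒Split : ∀ {B} → ¬ Connected G B → ∃ λ C → ∃ λ D → Split B C D ×
    Nonempty C × Nonempty D × (∀ {u v} → u ∈ C → v ∈ D → ¬ Adj u v)
  disconnected⇒Split {B} ¬conn
    with ¬∀⟶∃¬ d (λ u → ∀ v → u ∈ B → v ∈ B → Star (InducedAdj G B) u v)
           (λ u → all? λ v → (u ∈? B) →-dec ((v ∈? B) →-dec reachable? B u v)) ¬conn
  ... | u , ¬u with ¬∀⟶∃¬ d (λ v → u ∈ B → v ∈ B → Star (InducedAdj G B) u v)
                      (λ v → (u ∈? B) →-dec ((v ∈? B) →-dec reachable? B u v)) ¬u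
  ...   | v , ¬uv with u ∈? B | v ∈? B
  ...     | no u∉B  | _       = contradiction (λ u∈B → contradiction u∈B u∉B) ¬uv
  ...     | yes _   | no v∉B  = contradiction (λ _ v∈B → contradiction v∈B v∉B) ¬uv
  ...     | yes u∈B | yes v∈B = B ∩ K , B ∩ ∁ K , Split-∩ B K ,
    (u , x∈p∩q⁺ (u∈B , ∈-setOf⁺ (reachable? B u) ε)) ,
    (v , x∈p∩q⁺ (v∈B , x∉p⇒x∈∁p λ v∈K → ¬uv (λ _ _ → ∈-setOf⁻ (reachable? B u) v∈K))) ,
    λ x∈C y∈D x~y →
      let (x∈B , x∈K)  = x∈p∩q⁻ B K x∈C
          (y∈B , y∈∁K) = x∈p∩q⁻ B (∁ K) y∈D
      in x∈∁p⇒x∉p y∈∁K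
           (∈-setOf⁺ (reachable? B u) (∈-setOf⁻ (reachable? B u) x∈K ◅◅ ((x∈B , y∈B , x~y) ◅ ε)))
    where K = setOf (reachable? B u)

-- The Möbius function of the bond lattice

if-yes : ∀ {a p} {A : Set a} {P : Set p} (P? : Dec P) {x y : A} → P →
         (if does P? then x else y) ≡ x
if-yes (yes _) _ = ≡.refl
if-yes (no ¬p) p = contradiction p ¬p

if-no : ∀ {a p} {A : Set a} {P : Set p} (P? : Dec P) {x y : A} → ¬ P →
        (if does P? then x else y) ≡ y
if-no (yes p) ¬p = contradiction p ¬p
if-no (no _)  _  = ≡.refl

-- Restriction to a vertex set and to the blocks of a partition

module Restriction {c ℓ : Level} (R : CommutativeRing c ℓ) where

  open CommutativeRing R
  open SetFunctions R
  open SetoidReasoning setoid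

  when : ∀ {p} {P : Set p} → Dec P → Carrier → Carrier
  when P? x = if does P? then x else 0#

  when-yes : ∀ {p} {P : Set p} (P? : Dec P) {x} → P → when P? x ≈ x
  when-yes P? p = reflexive (if-yes P? p)

  when-no : ∀ {p} {P : Set p} (P? : Dec P) {x} → ¬ P → when P? x ≈ 0#
  when-no P? ¬p = reflexive (if-no P? ¬p)

  -- As a substitution it kills the variables outside `B`, so that `ind B ⊙ f` is `f` restricted to
  -- the subsets of `B`.
  ind : Subset d → Fin d → Carrier
  ind B v = if lookup B v then 1# else 0#

  χ-ind-⊆ : ∀ {U B : Subset d} → U ⊆ B → χ (ind B) U ≈ 1#
  χ-ind-⊆ {U = []}          {[]}          U⊆B = refl
  χ-ind-⊆ {U = outside ∷ U} {_ ∷ B}       U⊆B = χ-ind-⊆ (drop-∷-⊆ U⊆B)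
  χ-ind-⊆ {U = inside ∷ U}  {inside ∷ B}  U⊆B =
    trans (*-identityˡ _) (χ-ind-⊆ (drop-∷-⊆ U⊆B))
  χ-ind-⊆ {U = inside ∷ U}  {outside ∷ B} U⊆B = contradiction (U⊆B here) λ ()

  χ-ind-∉ : ∀ {U B : Subset d} {v} → v ∈ U → ¬ v ∈ B → χ (ind B) U ≈ 0#
  χ-ind-∉ {B = inside ∷ B}  here                  v∉B = contradiction here v∉B
  χ-ind-∉ {B = outside ∷ B} here                  v∉B = zeroˡ _
  χ-ind-∉ {U = outside ∷ U} {_ ∷ B} (there v∈U)   v∉B = χ-ind-∉ v∈U (v∉B ∘ there)
  χ-ind-∉ {U = inside ∷ U}  {_ ∷ B} (there v∈U)   v∉B =
    trans (*-congˡ (χ-ind-∉ v∈U (v∉B ∘ there))) (zeroʳ _)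

  χ-ind-⊈ : ∀ {U B : Subset d} → ¬ U ⊆ B → χ (ind B) U ≈ 0#
  χ-ind-⊈ {U = []}          {[]}          U⊈B = contradiction (λ ()) U⊈B
  χ-ind-⊈ {U = outside ∷ U} {_ ∷ B}       U⊈B =
    χ-ind-⊈ (λ U⊆B → U⊈B λ { (there v∈) → there (U⊆B v∈) })
  χ-ind-⊈ {U = inside ∷ U}  {inside ∷ B}  U⊈B =
    trans (*-congˡ (χ-ind-⊈ (λ U⊆B → U⊈B λ { here → here ; (there v∈) → there (U⊆B v∈) })))
          (zeroʳ _)
  χ-ind-⊈ {U = inside ∷ U}  {outside ∷ B} U⊈B = zeroˡ _

  -- Among the splits of `U` only the one into `U ∩ C` and `U ∩ D` can survive both restrictions,
  -- and it exists only if `U` lies in `B`.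
  ind-⋆ : ∀ {B C D : Subset d} → Split B C D → ∀ f g U →
          (ind C ⊙ f ⋆ ind D ⊙ g) U ≈ χ (ind B) U * (f (U ∩ C) * g (U ∩ D))
  ind-⋆ []      f g [] = trans (*-cong (*-identityˡ _) (*-identityˡ _)) (sym (*-identityˡ _))
  ind-⋆ (out s) f g (outside ∷ U) = ind-⋆ s (f ↾out) (g ↾out) U
  ind-⋆ (inˡ s) f g (outside ∷ U) = ind-⋆ s (f ↾out) (g ↾out) U
  ind-⋆ (inʳ s) f g (outside ∷ U) = ind-⋆ s (f ↾out) (g ↾out) U
  ind-⋆ {B = _ ∷ B} {_ ∷ C} {_ ∷ D} (out s) f g (inside ∷ U) = begin
    (ind C ⊙ f ↾out ⋆ (ind (outside ∷ D) ⊙ g) ↾in) U +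
    ((ind (outside ∷ C) ⊙ f) ↾in ⋆ ind D ⊙ g ↾out) U
      ≈⟨ +-cong (⋆-zeroʳ (ind C ⊙ f ↾out) (λ _ → trans (*-congʳ (zeroˡ _)) (zeroˡ _)) U)
                (⋆-zeroˡ (ind D ⊙ g ↾out) (λ _ → trans (*-congʳ (zeroˡ _)) (zeroˡ _)) U) ⟩
    0# + 0#
      ≈⟨ +-identityˡ 0# ⟩
    0#
      ≈⟨ trans (*-congʳ (zeroˡ _)) (zeroˡ _) ⟨
    χ (ind (outside ∷ B)) (inside ∷ U) * (f _ * g _) ∎
  ind-⋆ {B = _ ∷ B} {_ ∷ C} {_ ∷ D} (inˡ s) f g (inside ∷ U) = begin
    (ind C ⊙ f ↾out ⋆ (ind (outside ∷ D) ⊙ g) ↾in) U +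
    ((ind (inside ∷ C) ⊙ f) ↾in ⋆ ind D ⊙ g ↾out) U
      ≈⟨ +-cong (⋆-zeroʳ (ind C ⊙ f ↾out) (λ _ → trans (*-congʳ (zeroˡ _)) (zeroˡ _)) U)
                (⋆-congʳ {g = ind D ⊙ g ↾out} (λ _ → *-congʳ (*-identityˡ _)) U) ⟩
    0# + (ind C ⊙ f ↾in ⋆ ind D ⊙ g ↾out) U
      ≈⟨ trans (+-identityˡ _) (ind-⋆ s (f ↾in) (g ↾out) U) ⟩
    χ (ind B) U * (f (inside ∷ U ∩ C) * g (outside ∷ U ∩ D))
      ≈⟨ *-congʳ (*-identityˡ _) ⟨
    χ (ind (inside ∷ B)) (inside ∷ U) * (f _ * g _) ∎
  ind-⋆ {B = _ ∷ B} {_ ∷ C} {_ ∷ D} (inʳ s) f g (inside ∷ U) = begin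
    (ind C ⊙ f ↾out ⋆ (ind (inside ∷ D) ⊙ g) ↾in) U +
    ((ind (outside ∷ C) ⊙ f) ↾in ⋆ ind D ⊙ g ↾out) U
      ≈⟨ +-cong (⋆-congˡ {f = ind C ⊙ f ↾out} (λ _ → *-congʳ (*-identityˡ _)) U)
                (⋆-zeroˡ (ind D ⊙ g ↾out) (λ _ → trans (*-congʳ (zeroˡ _)) (zeroˡ _)) U) ⟩
    (ind C ⊙ f ↾out ⋆ ind D ⊙ g ↾in) U + 0#
      ≈⟨ trans (+-identityʳ _) (ind-⋆ s (f ↾out) (g ↾in) U) ⟩
    χ (ind B) U * (f (outside ∷ U ∩ C) * g (inside ∷ U ∩ D))
      ≈⟨ *-congʳ (*-identityˡ _) ⟨
    χ (ind (inside ∷ B)) (inside ∷ U) * (f _ * g _) ∎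

  ind-⊙-⊆ : ∀ {B C : Subset d} f → B ⊆ C → ind C ⊙ ind B ⊙ f ≐ ind B ⊙ f
  ind-⊙-⊆ {B = B} f B⊆C U with U ⊆? B
  ... | yes U⊆B = trans (*-congʳ (χ-ind-⊆ (B⊆C ∘ U⊆B))) (*-identityˡ _)
  ... | no U⊈B  = trans (*-congˡ vanishes) (trans (zeroʳ _) (sym vanishes))
    where vanishes = trans (*-congʳ (χ-ind-⊈ U⊈B)) (zeroˡ _)

  δ-⊥ : ∀ {d} → δ (⊥ {d}) ≈ 1#
  δ-⊥ {zero}  = refl
  δ-⊥ {suc d} = δ-⊥ {d}

  δ-Nonempty : ∀ {U : Subset d} → Nonempty U → δ U ≈ 0#
  δ-Nonempty {U = inside ∷ U}  _                       = refl
  δ-Nonempty {U = outside ∷ U} (Fin.suc v , there v∈U) = δ-Nonempty (v , v∈U)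

  tiling-Tiles : ∀ {π : Blocks d} {U} → Tiles π U → tiling π U ≈ 1#
  tiling-Tiles {d} []              = δ-⊥ {d}
  tiling-Tiles (_∷_ {π = π} s t) = trans (single⋆-split (tiling π) s) (tiling-Tiles t)

  tiling-¬Tiles : ∀ (π : Blocks d) U → ¬ Tiles π U → tiling π U ≈ 0#
  tiling-¬Tiles []      U ¬t with nonempty? U
  ... | yes U≠∅ = δ-Nonempty U≠∅
  ... | no U≡∅  = contradiction (≡.subst (Tiles []) (≡.sym (Empty-unique U≡∅)) []) ¬t
  tiling-¬Tiles (B ∷ π) U ¬t with split? U B
  ... | yes (S , s) = trans (single⋆-split (tiling π) s) (tiling-¬Tiles π S (λ t → ¬t (s ∷ t)))
  ... | no ¬s       = single⋆-unsplit (tiling π) U B ¬s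

  restrict : SetFunction d → Blocks d → SetFunction d
  restrict f []      = δ
  restrict f (C ∷ π) = ind C ⊙ f ⋆ restrict f π

  -- Lets the product over the remaining blocks be rewritten as a restriction to their union, the
  -- shape to which `ind-⋆` applies.
  restrict-⊆ : ∀ f {π : Blocks d} {S} → All (_⊆ S) π → ind S ⊙ restrict f π ≐ restrict f π
  restrict-⊆ f         []           = ⊙-δ _
  restrict-⊆ f {C ∷ π} {S} (C⊆S ∷ π⊆S) =
    ≐-trans (≐-sym (⊙-⋆ (ind S) (ind C ⊙ f) (restrict f π)))
            (⋆-cong (ind-⊙-⊆ f C⊆S) (restrict-⊆ f π⊆S))

  restrict-Tiles : ∀ f {π : Blocks d} {U} → Tiles π U → restrict f π U ≈ prod f π
  restrict-Tiles {d} f []    = δ-⊥ {d}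
  restrict-Tiles f (_∷_ {B} {π} {U} {S} s t) = begin
    (ind B ⊙ f ⋆ restrict f π) U
      ≈⟨ ⋆-congˡ {f = ind B ⊙ f} (restrict-⊆ f (All.tabulate π⊆S)) U ⟨
    (ind B ⊙ f ⋆ ind S ⊙ restrict f π) U
      ≈⟨ ind-⋆ s f (restrict f π) U ⟩
    χ (ind U) U * (f (U ∩ B) * restrict f π (U ∩ S))
      ≈⟨ trans (*-congʳ (χ-ind-⊆ {U = U} ⊆-refl)) (*-identityˡ _) ⟩
    f (U ∩ B) * restrict f π (U ∩ S)
      ≡⟨ ≡.cong₂ (λ T T′ → f T * restrict f π T′) (Split⇒∩ s) (Split⇒∩ (Split-sym s)) ⟩
    f B * restrict f π S
      ≈⟨ *-congˡ (restrict-Tiles f t) ⟩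
    f B * prod f π ∎
    where
    π⊆S : ∀ {C} → C List∈.∈ π → C ⊆ S
    π⊆S C∈π {v} v∈C = ≡.subst (v ∈_) (Tiles⇒⋃ t) (∈-⋃⁺ C∈π v∈C)

  -- A vertex of `B` lies in at most one block, so at most one summand is nonzero. This makes the
  -- weight "`f` on sets inside some block" additive over the blocks, ready for `E`.
  sum-blocks : ∀ (f : SetFunction d) {π : Blocks d} →
    AllPairs (λ B C → Empty (B ∩ C)) π → ∀ {B} → Nonempty B →
    sum (λ C → (ind C ⊙ f) B) π ≈ when (Any.any? (B ⊆?_) π) (f B)
  sum-blocks f {π} π# {B} (v , v∈B) with Any.any? (B ⊆?_) π
  ... | yes B≤π = some π# B≤π
    where
    some : ∀ {π} → AllPairs (λ B C → Empty (B ∩ C)) π → Any (B ⊆_) π →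
           sum (λ C → (ind C ⊙ f) B) π ≈ f B
    some {C ∷ π} (C# ∷ _) (here B⊆C) = trans
      (+-cong (trans (*-congʳ (χ-ind-⊆ B⊆C)) (*-identityˡ _))
              (sum-zero π (λ D∈ → trans
                (*-congʳ (χ-ind-∉ v∈B λ v∈D → All.lookup C# D∈ (v , x∈p∩q⁺ (B⊆C v∈B , v∈D))))
                (zeroˡ _))))
      (+-identityʳ _)
    some {C ∷ π} (C# ∷ π#) (there B≤π) with List∈.find B≤π
    ... | D , D∈ , B⊆D = trans
      (+-cong (trans (*-congʳ (χ-ind-∉ v∈B λ v∈C →
                        All.lookup C# D∈ (v , x∈p∩q⁺ (v∈C , B⊆D v∈B))))
                     (zeroˡ _))
              (some π# B≤π))
      (+-identityˡ _)
  ... | no B≰π = sum-zero π λ C∈ →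
    trans (*-congʳ (χ-ind-⊈ λ B⊆C → B≰π (List∈.lose C∈ B⊆C))) (zeroˡ _)

  E-restrict : ∀ (w : SetFunction d) π → E (λ B → sum (λ C → (ind C ⊙ w) B) π) ≐ restrict (E w) π
  E-restrict w []      = E-zero (λ _ _ → refl)
  E-restrict w (C ∷ π) = ≐-trans (E-⊕ (ind C ⊙ w) (λ B → sum (λ C → (ind C ⊙ w) B) π))
    (⋆-cong (E-⊙ (ind C) w) (E-restrict w π))

  restrict-cong : ∀ {f g : SetFunction d} π → f ≐ g → restrict f π ≐ restrict g π
  restrict-cong []      f≐g U = refl
  restrict-cong (C ∷ π) f≐g   = ⋆-cong (⊙-cong (ind C) f≐g) (restrict-cong π f≐g)

-- Sums over bonds

module BondSums {c ℓ : Level} (R : CommutativeRing c ℓ) {d : ℕ} (G : SimpleGraph d) where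

  open CommutativeRing R
  open AbelianGroupProperties +-abelianGroup using (inverseˡ-unique)
  open SetFunctions R
  open Restriction R
  open SetoidReasoning setoid
  open SimpleGraph G

  -- A family of sets that is not a bond drops out of `E w ⊤` for one of two reasons: some member is
  -- empty or disconnected, and its weight vanishes; or all members are good but do not tile `⊤`,
  -- and `tiling` vanishes.
  sum-bonds : ∀ (w : SetFunction d) → w ⊥ ≈ 0# → (∀ B → ¬ Connected G B → w B ≈ 0#) →
              sum (prod w) (bonds G) ≈ E w ⊤
  sum-bonds w w⊥≈0 w-disc = trans
    (sum-filter (λ π → isPartition? π ×-dec All.all? (connected? G) π) (sublists (subsets d))
      (λ _ (π-part , _) →
        sym (trans (*-congˡ (tiling-Tiles (IsPartition⇒Tiles π-part))) (*-identityʳ _)))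
      (λ _ → other))
    (sym (E-partitions w w⊥≈0 ⊤))
    where
    bad : ∀ {B} → ¬ (Nonempty B × Connected G B) → w B ≈ 0#
    bad {B} ¬good with nonempty? B
    ... | yes B≠∅ = w-disc B (λ conn → ¬good (B≠∅ , conn))
    ... | no B≡∅  = ≡.subst (λ C → w C ≈ 0#) (≡.sym (Empty-unique B≡∅)) w⊥≈0
    other : ∀ {π} → ¬ (IsPartition π × All (Connected G) π) → prod w π * tiling π ⊤ ≈ 0#
    other {π} ¬bond with All.all? (λ B → nonempty? B ×-dec connected? G B) π
    ... | yes good = trans
      (*-congˡ (tiling-¬Tiles π ⊤ (λ t →
        ¬bond (Tiles⇒IsPartition (All.map proj₁ good) t , All.map proj₂ good))))
      (zeroʳ _)
    ... | no ¬good = trans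
      (*-congʳ (prod-zero (Any.map bad
        (¬All⇒Any¬ (λ B → nonempty? B ×-dec connected? G B) π ¬good))))
      (zeroˡ _)

  indep : SetFunction d
  indep T = when (independent? G T) 1#

  indep-yes : ∀ {T} → Independent G T → indep T ≈ 1#
  indep-yes {T} = when-yes (independent? G T)

  indep-no : ∀ {T} → ¬ Independent G T → indep T ≈ 0#
  indep-no {T} = when-no (independent? G T)

  indep-⊥ : indep ⊥ ≈ 1#
  indep-⊥ = indep-yes (λ _ _ u∈ → contradiction u∈ ∉⊥)

  w : SetFunction d
  w = Log indep

  E-w : E w ≐ indep
  E-w = E-Log indep indep-⊥

  indep-∩ : ∀ {B C D} → Split B C D → (∀ {u v} → u ∈ C → v ∈ D → ¬ Adj u v) →
            ∀ {U} → U ⊆ B → indep (U ∩ C) * indep (U ∩ D) ≈ indep U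
  indep-∩ {B} {C} {D} s C≁D {U} U⊆B with independent? G (U ∩ C) | independent? G (U ∩ D)
  ... | yes C-indep | yes D-indep = trans
    (*-cong (indep-yes C-indep) (indep-yes D-indep))
    (trans (*-identityˡ 1#) (sym (indep-yes U-indep)))
    where
    U-indep : Independent G U
    U-indep u v u∈U v∈U u~v with Split⇒∈ s (U⊆B u∈U) | Split⇒∈ s (U⊆B v∈U)
    ... | inj₁ u∈C | inj₁ v∈C = C-indep u v (x∈p∩q⁺ (u∈U , u∈C)) (x∈p∩q⁺ (v∈U , v∈C)) u~v
    ... | inj₁ u∈C | inj₂ v∈D = C≁D u∈C v∈D u~v
    ... | inj₂ u∈D | inj₁ v∈C = C≁D v∈C u∈D (adj-sym u~v)
    ... | inj₂ u∈D | inj₂ v∈D = D-indep u v (x∈p∩q⁺ (u∈U , u∈D)) (x∈p∩q⁺ (v∈U , v∈D)) u~v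
  ... | no C-dep | _ = trans (trans (*-congʳ (indep-no C-dep)) (zeroˡ _))
    (sym (indep-no (λ U-indep → C-dep (λ u v u∈ v∈ → U-indep u v (p∩q⊆p U C u∈) (p∩q⊆p U C v∈)))))
  ... | yes _ | no D-dep = trans (trans (*-congˡ (indep-no D-dep)) (zeroʳ _))
    (sym (indep-no (λ U-indep → D-dep (λ u v u∈ v∈ → U-indep u v (p∩q⊆p U D u∈) (p∩q⊆p U D v∈)))))

  -- If B = C ⊔ D has no edge between C and D, then on subsets of B the function indep is
  -- the ⋆-product of its restrictions to C and D, and Log turns this into a sum of two
  -- functions that both vanish at B.
  w-disconnected : ∀ B → ¬ Connected G B → w B ≈ 0#
  w-disconnected B ¬conn with disconnected⇒Split G ¬conn
  ... | C , D , s , (c , c∈C) , (d , d∈D) , C≁D = begin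
    w B
      ≈⟨ trans (*-congʳ (χ-ind-⊆ {U = B} ⊆-refl)) (*-identityˡ _) ⟨
    χ (ind B) B * w B
      ≈⟨ E-injective (ind B ⊙ w) (ind C ⊙ w ⊕ ind D ⊙ w) E≐ B (c , Split⇒⊆ˡ s c∈C) ⟩
    χ (ind C) B * w B + χ (ind D) B * w B
      ≈⟨ +-cong (*-congʳ (χ-ind-∉ (Split⇒⊆ʳ s d∈D) λ d∈C → Split⇒disjoint s d∈C d∈D))
                (*-congʳ (χ-ind-∉ (Split⇒⊆ˡ s c∈C) (Split⇒disjoint s c∈C))) ⟩
    0# * w B + 0# * w B
      ≈⟨ trans (+-cong (zeroˡ _) (zeroˡ _)) (+-identityˡ 0#) ⟩
    0# ∎
    where
    indep-⋆ : ind C ⊙ indep ⋆ ind D ⊙ indep ≐ ind B ⊙ indep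
    indep-⋆ U with U ⊆? B
    ... | yes U⊆B = trans (ind-⋆ s indep indep U) (*-congˡ (indep-∩ s C≁D U⊆B))
    ... | no U⊈B  = trans (ind-⋆ s indep indep U)
      (trans (trans (*-congʳ (χ-ind-⊈ U⊈B)) (zeroˡ _))
             (sym (trans (*-congʳ (χ-ind-⊈ U⊈B)) (zeroˡ _))))
    E≐ : E (ind B ⊙ w) ≐ E (ind C ⊙ w ⊕ ind D ⊙ w)
    E≐ = ≐-trans (E-⊙ (ind B) w) (≐-trans (⊙-cong (ind B) E-w) (≐-trans (≐-sym indep-⋆)
      (≐-trans (⋆-cong (⊙-cong (ind C) (≐-sym E-w)) (⊙-cong (ind D) (≐-sym E-w)))
        (≐-trans (⋆-cong (≐-sym (E-⊙ (ind C) w)) (≐-sym (E-⊙ (ind D) w)))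
          (≐-sym (E-⊕ (ind C ⊙ w) (ind D ⊙ w)))))))

  -- Refinement is a condition on each block of τ separately, so it can be absorbed into the weight
  -- as `w′`. On nonempty sets `w′` is the sum of the restrictions of `w` to the blocks of `π`, and
  -- `E` turns this sum into the convolution of the restrictions of `indep`.
  sum-refinements : ∀ {π} → IsPartition π →
    sum (λ τ → when (τ ≤? π) (prod w τ)) (bonds G) ≈ prod indep π
  sum-refinements {π} π-part@(_ , π# , _) = begin
    sum (λ τ → when (τ ≤? π) (prod w τ)) (bonds G)
      ≈⟨ sum-cong (bonds G) restricted ⟨
    sum (prod w′) (bonds G)
      ≈⟨ sum-bonds w′ (vanish ⊥ (Log-⊥ indep)) (λ B → vanish B ∘ w-disconnected B) ⟩
    E w′ ⊤
      ≈⟨ E-cong (λ B B≠∅ → sym (sum-blocks w π# B≠∅)) ⊤ ⟩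
    E (λ B → sum (λ C → (ind C ⊙ w) B) π) ⊤
      ≈⟨ ≐-trans (E-restrict w π) (restrict-cong π E-w) ⊤ ⟩
    restrict indep π ⊤
      ≈⟨ restrict-Tiles indep (IsPartition⇒Tiles π-part) ⟩
    prod indep π ∎
    where
    w′ : SetFunction d
    w′ B = when (Any.any? (B ⊆?_) π) (w B)
    vanish : ∀ B → w B ≈ 0# → w′ B ≈ 0#
    vanish B wB≈0 with does (Any.any? (B ⊆?_) π)
    ... | true  = wB≈0
    ... | false = refl
    restricted : ∀ τ → prod w′ τ ≈ when (τ ≤? π) (prod w τ)
    restricted τ with τ ≤? π
    ... | yes τ≤π = prod-cong (All.map (λ {B} → when-yes (Any.any? (B ⊆?_) π)) τ≤π)
    ... | no τ≰π  = prod-zero (Any.map (λ {B} → when-no (Any.any? (B ⊆?_) π))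
                      (¬All⇒Any¬ (λ B → Any.any? (B ⊆?_) π) τ τ≰π))

  sum-indicator : ∀ (f : Blocks d → Carrier) {πs π} → Unique πs → π List∈.∈ πs →
                  sum (λ τ → when (π ≟ τ) (f τ)) πs ≈ f π
  sum-indicator f {π ∷ πs} (π∉ ∷ _) (here ≡.refl) = trans
    (+-cong (when-yes (π ≟ π) ≡.refl)
            (sum-zero πs (λ {τ} τ∈ → when-no (π ≟ τ) (All.lookup π∉ τ∈))))
    (+-identityʳ _)
  sum-indicator f {τ ∷ πs} {π} (τ∉ ∷ πs!) (there π∈) = trans
    (+-cong (when-no (π ≟ τ) (All.lookup τ∉ π∈ ∘ ≡.sym)) (sum-indicator f πs! π∈))
    (+-identityˡ _)

  -- Since `τ < π` means `τ ≤ π` without `π ≤ τ`, antisymmetry on bonds is what makes τ = π the only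
  -- other case.
  sum-lower : ∀ (f : Blocks d → Carrier) {π} → π List∈.∈ bonds G →
    sum (λ τ → when (τ ≤? π) (f τ)) (bonds G) ≈
    f π + sum (λ τ → when (τ <? π) (f τ)) (bonds G)
  sum-lower f {π} π∈ = begin
    sum (λ τ → when (τ ≤? π) (f τ)) (bonds G)
      ≈⟨ sum-cong-∈ (bonds G) dichotomy ⟩
    sum (λ τ → when (π ≟ τ) (f τ) + when (τ <? π) (f τ)) (bonds G)
      ≈⟨ sum-+ _ _ (bonds G) ⟩
    sum (λ τ → when (π ≟ τ) (f τ)) (bonds G) + sum (λ τ → when (τ <? π) (f τ)) (bonds G)
      ≈⟨ +-congʳ (sum-indicator f (bonds-! G) π∈) ⟩
    f π + sum (λ τ → when (τ <? π) (f τ)) (bonds G) ∎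
    where
    dichotomy : ∀ {τ} → τ List∈.∈ bonds G →
                when (τ ≤? π) (f τ) ≈ when (π ≟ τ) (f τ) + when (τ <? π) (f τ)
    dichotomy {τ} τ∈ = cases (π ≟ τ) (τ ≤? π)
      where
      cases : Dec (π ≡ τ) → Dec (τ ≤ π) →
              when (τ ≤? π) (f τ) ≈ when (π ≟ τ) (f τ) + when (τ <? π) (f τ)
      cases (yes ≡.refl) _ = trans (when-yes (π ≤? π) ≤-refl) (sym (trans
        (+-cong (when-yes (π ≟ π) ≡.refl) (when-no (π <? π) (λ (_ , π≰π) → π≰π ≤-refl)))
        (+-identityʳ _)))
      cases (no π≢τ) (yes τ≤π) = trans (when-yes (τ ≤? π) τ≤π) (sym (trans
        (+-cong (when-no (π ≟ τ) π≢τ)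
                (when-yes (τ <? π) (τ≤π , λ π≤τ → π≢τ (bonds-antisym G π∈ τ∈ π≤τ τ≤π))))
        (+-identityˡ _)))
      cases (no π≢τ) (no τ≰π) = trans (when-no (τ ≤? π) τ≰π) (sym (trans
        (+-cong (when-no (π ≟ τ) π≢τ) (when-no (τ <? π) (τ≰π ∘ proj₁)))
        (+-identityˡ _)))

  module _ {ι : ℤ → Carrier} (ι-hom : IsRingHomomorphism ℤ.+-*-rawRing rawRing ι) where
    open IsRingHomomorphism ι-hom

    ι-sum : ∀ {a} {A : Set a} (f : A → ℤ) xs →
            ι (foldr ℤ._+_ 0ℤ (map f xs)) ≈ sum (ι ∘ f) xs
    ι-sum f []       = 0#-homo
    ι-sum f (x ∷ xs) = trans (+-homo _ _) (+-congˡ (ι-sum f xs))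

    private
      indep-0̂ : prod indep (0̂ {d}) ≈ 1#
      indep-0̂ = prod-one (All.tabulate λ {B} B∈ → indep-yes {B}
        λ u v u∈ v∈ u~v → adj-irrefl (≡.subst (Adj u) (∈0̂⇒≡ B∈ v∈ u∈) u~v))

      indep-≢0̂ : ∀ {π} → π List∈.∈ bonds G → ¬ 0̂ ≡ π → prod indep π ≈ 0#
      indep-≢0̂ {π} π∈ 0̂≢π with All.all? (independent? G) π
      ... | yes π-indep = contradiction (independent-bond⇒0̂ G π∈ π-indep) 0̂≢π
      ... | no ¬indep   = prod-zero (Any.map indep-no
                            (¬All⇒Any¬ (independent? G) π ¬indep))

      lower : ∀ {π} → π List∈.∈ bonds G →
              prod w π + sum (λ τ → when (τ <? π) (prod w τ)) (bonds G) ≈ prod indep π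
      lower π∈ = trans (sym (sum-lower (prod w) π∈))
                       (sum-refinements (proj₁ (proj₂ (∈-bonds⁻ G π∈))))

    -- Every bond lies above `0̂`, so the recursion for `μ` sums over all bonds strictly below `π`,
    -- and `lower` gives the same recursion for `prod w`. The statement is general in the
    -- accessibility proof because the recursive calls of `μ-acc` use `rec τ<π` and not
    -- `<-wellFounded`.
    ι-μ-acc : ∀ {π} → π List∈.∈ bonds G → (a : Acc _<_ π) → ι (μ-acc G 0̂ π a) ≈ prod w π
    ι-μ-acc {π} π∈ (acc rec) = cases (0̂ ≟ π)
      where
      0̂≤π : 0̂ ≤ π
      0̂≤π = 0̂-minimum (proj₁ (proj₂ (∈-bonds⁻ G π∈)))
      summand-< : ∀ {τ} → τ List∈.∈ bonds G → τ < π → ι (μ-summand G 0̂ π rec τ) ≈ prod w τ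
      summand-< {τ} τ∈ τ<π with 0̂ ≤? τ | τ <? π
      ... | yes _  | yes τ<π′ = ι-μ-acc τ∈ (rec τ<π′)
      ... | yes _  | no τ≮π   = contradiction τ<π τ≮π
      ... | no 0̂≰τ | _        = contradiction (0̂-minimum (proj₁ (proj₂ (∈-bonds⁻ G τ∈)))) 0̂≰τ
      summand-≮ : ∀ {τ} → ¬ τ < π → ι (μ-summand G 0̂ π rec τ) ≈ 0#
      summand-≮ {τ} τ≮π with 0̂ ≤? τ | τ <? π
      ... | yes _ | yes τ<π = contradiction τ<π τ≮π
      ... | yes _ | no _    = 0#-homo
      ... | no _  | _       = 0#-homo
      summand : ∀ {τ} → τ List∈.∈ bonds G →
                ι (μ-summand G 0̂ π rec τ) ≈ when (τ <? π) (prod w τ)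
      summand {τ} τ∈ = cases (τ <? π)
        where
        cases : Dec (τ < π) → ι (μ-summand G 0̂ π rec τ) ≈ when (τ <? π) (prod w τ)
        cases (yes τ<π) = trans (summand-< τ∈ τ<π) (sym (when-yes (τ <? π) τ<π))
        cases (no τ≮π)  = trans (summand-≮ τ≮π) (sym (when-no (τ <? π) τ≮π))
      cases : Dec (0̂ ≡ π) → ι (μ-acc G 0̂ π (acc rec)) ≈ prod w π
      cases (yes ≡.refl) = begin
        ι (μ-acc G 0̂ 0̂ (acc rec))
          ≡⟨ ≡.cong ι (if-yes (0̂ {d} ≟ 0̂) ≡.refl) ⟩
        ι 1ℤ
          ≈⟨ trans 1#-homo (sym (trans (lower π∈) indep-0̂)) ⟩
        prod w 0̂ + sum (λ τ → when (τ <? 0̂) (prod w τ)) (bonds G)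
          ≈⟨ +-congˡ (sum-zero (bonds G) λ {τ} τ∈ → when-no (τ <? 0̂) λ (_ , 0̂≰τ) →
               0̂≰τ (0̂-minimum (proj₁ (proj₂ (∈-bonds⁻ G τ∈))))) ⟩
        prod w 0̂ + 0#
          ≈⟨ +-identityʳ _ ⟩
        prod w 0̂ ∎
      cases (no 0̂≢π) = begin
        ι (μ-acc G 0̂ π (acc rec))
          ≡⟨ ≡.cong ι (≡.trans (if-no (0̂ ≟ π) 0̂≢π) (if-yes (0̂ <? π)
               (0̂≤π , λ π≤0̂ → 0̂≢π (bonds-antisym G (0̂∈bonds G) π∈ 0̂≤π π≤0̂)))) ⟩
        ι (ℤ.- foldr ℤ._+_ 0ℤ (map (μ-summand G 0̂ π rec) (bonds G)))
        ≈⟨ trans (-‿homo _) (-‿cong (ι-sum (μ-summand G 0̂ π rec) (bonds G))) ⟩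
        - sum (ι ∘ μ-summand G 0̂ π rec) (bonds G)
          ≈⟨ -‿cong (sum-cong-∈ (bonds G) summand) ⟩
        - sum (λ τ → when (τ <? π) (prod w τ)) (bonds G)
          ≈⟨ inverseˡ-unique _ _ (trans (lower π∈) (indep-≢0̂ π∈ 0̂≢π)) ⟨
        prod w π ∎

    ι-μ : ∀ {π} → π List∈.∈ bonds G → ι (μ G 0̂ π) ≈ prod w π
    ι-μ π∈ = ι-μ-acc π∈ (<-wellFounded _)

-- Acyclic orientations

-- The image of `xs` under `f` is duplicate-free with the same members as `ys`, hence a permutation
-- of it.
bijection⇒length≡ : ∀ {A B : Set} {xs : List A} {ys : List B} → Unique xs → Unique ys →
  (f : A → B) (g : B → A) →
  (∀ {x} → x List∈.∈ xs → f x List∈.∈ ys × g (f x) ≡ x) →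
  (∀ {y} → y List∈.∈ ys → g y List∈.∈ xs × f (g y) ≡ y) →
  length xs ≡ length ys
bijection⇒length≡ {xs = xs} {ys} xs! ys! f g f∈ g∈ =
  ≡.trans (≡.sym (length-map f xs))
    (↭-length (∼bag⇒↭ (unique∧set⇒bag (map-! xs! (proj₂ ∘ f∈)) ys! (mk⇔ to from))))
  where
  map-! : ∀ {zs} → Unique zs → (∀ {x} → x List∈.∈ zs → g (f x) ≡ x) → Unique (map f zs)
  map-! []           _  = []
  map-! {z ∷ zs} (z∉ ∷ zs!) gf = All.tabulate fresh ∷ map-! zs! (gf ∘ there)
    where
    fresh : ∀ {y} → y List∈.∈ map f zs → ¬ f z ≡ y
    fresh y∈ fz≡y with ∈-map⁻ f y∈
    ... | x , x∈ , y≡fx = All.lookup z∉ x∈ (≡.trans (≡.sym (gf (here ≡.refl)))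
      (≡.trans (≡.cong g (≡.trans fz≡y y≡fx)) (gf (there x∈))))
  to : ∀ {y} → y List∈.∈ map f xs → y List∈.∈ ys
  to y∈ with ∈-map⁻ f y∈
  ... | x , x∈ , ≡.refl = proj₁ (f∈ x∈)
  from : ∀ {y} → y List∈.∈ ys → y List∈.∈ map f xs
  from y∈ with g∈ y∈
  ... | gy∈ , fgy≡y = ≡.subst (List∈._∈ map f xs) fgy≡y (∈-map⁺ f gy∈)

lookup-injective : ∀ {A : Set} {xs : List A} → Unique xs → ∀ {i j} →
                   List.lookup xs i ≡ List.lookup xs j → i ≡ j
lookup-injective (_ ∷ _)    {Fin.zero}  {Fin.zero}  _  = ≡.refl
lookup-injective (x∉ ∷ _)   {Fin.zero}  {Fin.suc j} eq =
  contradiction eq (All.lookup x∉ (∈-lookup j))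
lookup-injective (x∉ ∷ _)   {Fin.suc i} {Fin.zero}  eq =
  contradiction (≡.sym eq) (All.lookup x∉ (∈-lookup i))
lookup-injective (_ ∷ xs!)  {Fin.suc i} {Fin.suc j} eq =
  ≡.cong Fin.suc (lookup-injective xs! eq)

unique⇒length≤ : {xs : List (Fin d)} → Unique xs → length xs ℕ.≤ d
unique⇒length≤ xs! = Fin.injective⇒≤ (lookup-injective xs!)

module _ {A : Set} {R : Rel A 0ℓ} where

  Linked-snoc : ∀ xs {x y} → Linked R (xs ++ [ x ]) → R x y → Linked R ((xs ++ [ x ]) ++ [ y ])
  Linked-snoc []            _        Rxy = Rxy ∷ [-]
  Linked-snoc (z ∷ [])      (r ∷ rs) Rxy = r ∷ Linked-snoc [] rs Rxy
  Linked-snoc (z ∷ z′ ∷ xs) (r ∷ rs) Rxy = r ∷ Linked-snoc (z′ ∷ xs) rs Rxy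

  -- When a walk returns to `x`, cutting off what precedes the earlier visit leaves a cycle.
  Linked-extract : ∀ {xs x} → x List∈.∈ xs → Unique xs → Linked R (xs ++ [ x ]) →
                   ∃ λ ys → Unique (x ∷ ys) × Linked R (x ∷ ys ++ [ x ])
  Linked-extract (here ≡.refl) xs! rs = _ , xs! , rs
  Linked-extract (there x∈)    xs! rs = Linked-extract x∈ (AllPairs.tail xs!) (Linked.tail rs)

  -- Replaces each step using the knowledge that a further step follows it. The extra `R x y`
  -- supplies the successor of the last vertex; on a cycle it is the first arc again.
  Linked-successors : ∀ {R′ : Rel A 0ℓ} → (∀ {x y z} → R x y → R y z → R′ x y) →
    ∀ xs {x y} → Linked R (xs ++ [ x ]) → R x y → Linked R′ (xs ++ [ x ])
  Linked-successors step []            _                 _   = [-]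
  Linked-successors step (z ∷ [])      (r ∷ [-])         Rxy = step r Rxy ∷ [-]
  Linked-successors step (z ∷ z′ ∷ xs) (r ∷ rs)          Rxy =
    step r (Linked-head xs rs) ∷ Linked-successors step (z′ ∷ xs) rs Rxy
    where
    Linked-head : ∀ xs {z x} → Linked R (z ∷ xs ++ [ x ]) → R z (List.foldr (λ y _ → y) x xs)
    Linked-head []       (r ∷ _) = r
    Linked-head (_ ∷ _)  (r ∷ _) = r

  cycle-successor : ∀ xs {x} → Linked R (x ∷ xs ++ [ x ]) → ∃ λ y → R x y
  cycle-successor []       (r ∷ _) = _ , r
  cycle-successor (_ ∷ _)  (r ∷ _) = _ , r

-- Walking along arcs inside U must eventually revisit a vertex.
acyclic⇒terminal : ∀ {o : Arcs d} {U} → Acyclic o → Nonempty U →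
                   ¬ (∀ v → v ∈ U → ∃ λ w → w ∈ U × (v , w) ∈ₐ o)
acyclic⇒terminal {d} {o} {U} acyclic (u , u∈U) next =
  walk d [] (ℕ.+-identityʳ d) [-] [] u∈U
  where
  walk : ∀ n q {v} → n ℕ.+ length q ≡ d → Linked (λ x y → (x , y) ∈ₐ o) (q ++ [ v ]) →
         Unique q → ¬ v ∈ U
  walk n q {v} n≡ linked q! v∈U with member? Fin._≟_ v q
  ... | yes v∈q = uncurry (acyclic v) (Linked-extract v∈q q! linked)
  ... | no v∉q  = extend n n≡
    where
    q∷ʳv! : Unique (q ++ [ v ])
    q∷ʳv! = Unique.++⁺ q! ([] ∷ []) λ { (x∈q , here ≡.refl) → v∉q x∈q }
    length-q∷ʳv : length (q ++ [ v ]) ≡ suc (length q)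
    length-q∷ʳv = ≡.trans (length-++ q) (ℕ.+-comm (length q) 1)
    extend : ∀ n → n ℕ.+ length q ≢ d
    -- `n` counts the vertices not yet in `q`; at zero, `q ++ [ v ]` would consist of d + 1 distinct
    -- vertices.
    extend zero    n≡ = ℕ.1+n≰n (≡.subst (ℕ._≤ d)
      (≡.trans length-q∷ʳv (≡.cong suc n≡)) (unique⇒length≤ q∷ʳv!))
    extend (suc m) n≡ with next v v∈U
    ... | w , w∈U , vw = walk m (q ++ [ v ])
      (≡.trans (≡.cong (m ℕ.+_) length-q∷ʳv) (≡.trans (ℕ.+-suc m (length q)) n≡))
      (Linked-snoc q linked vw) q∷ʳv! w∈U

acyclic-⊆ : ∀ {o o′ : Arcs d} → (∀ {a} → a ∈ₐ o′ → a ∈ₐ o) → Acyclic o → Acyclic o′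
acyclic-⊆ o′⊆o acyclic v vs (vs! , linked) = acyclic v vs (vs! , Linked.map o′⊆o linked)

allArcs : ∀ d → Arcs d
allArcs d = cartesianProduct (allFin d) (allFin d)

∈-allArcs : ∀ (a : Fin d × Fin d) → a ∈ₐ allArcs d
∈-allArcs (u , v) = ∈-cartesianProduct⁺ (∈-allFin u) (∈-allFin v)

allArcs-! : ∀ d → Unique (allArcs d)
allArcs-! d = Unique.cartesianProduct⁺ (Unique.allFin⁺ d) (Unique.allFin⁺ d)

module _ (G : SimpleGraph d) where

  IsAcyclicOrientation : Arcs d → Set
  IsAcyclicOrientation o = IsOrientation G o × Acyclic o

  isAcyclicOrientation? : Decidable IsAcyclicOrientation
  isAcyclicOrientation? o = isOrientation? G o ×-dec acyclic? o

  ∈-acyclicOrientations⁺ : ∀ {o} → o List∈.∈ sublists (allArcs d) → IsAcyclicOrientation o →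
                           o List∈.∈ acyclicOrientations G
  ∈-acyclicOrientations⁺ = ∈-filter⁺ isAcyclicOrientation?

  ∈-acyclicOrientations⁻ : ∀ {o} → o List∈.∈ acyclicOrientations G →
                           o List∈.∈ sublists (allArcs d) × IsAcyclicOrientation o
  ∈-acyclicOrientations⁻ = ∈-filter⁻ isAcyclicOrientation? {xs = sublists (allArcs d)}

  acyclicOrientations-! : Unique (acyclicOrientations G)
  acyclicOrientations-! = Unique.filter⁺ isAcyclicOrientation? (sublists-! (allArcs-! d))

  orientation-antisym : ∀ {o} → IsOrientation G o → ∀ {u v} → (u , v) ∈ₐ o → ¬ (v , u) ∈ₐ o
  orientation-antisym (o⊆ , one) {u} {v} uv vu with one u v (All.lookup o⊆ uv)
  ... | inj₁ (_ , ¬vu) = ¬vu vu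
  ... | inj₂ (¬uv , _) = ¬uv uv

  sinkSet : Arcs d → Subset d
  sinkSet o = setOf (isSink? G o)

infix 9 _↾_

-- The induced subgraph G[U], with the vertices outside U kept as isolated vertices.
_↾_ : SimpleGraph d → Subset d → SimpleGraph d
G ↾ U = record
  { Adj        = λ u v → u ∈ U × v ∈ U × Adj u v
  ; adj?       = λ u v → (u ∈? U) ×-dec ((v ∈? U) ×-dec adj? u v)
  ; adj-sym    = λ (u∈ , v∈ , u~v) → v∈ , u∈ , adj-sym u~v
  ; adj-irrefl = λ (_ , _ , v~v) → adj-irrefl v~v }
  where open SimpleGraph G

module _ (G : SimpleGraph d) where
  open SimpleGraph G

  -- Vertices outside `U` are isolated and trivially sinks, so the sink is sought in `U`. A vertex
  -- of `U` that is not a sink has an arc to a neighbour in `U`, and these arcs cannot continue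
  -- forever.
  sink-exists : ∀ {U o} → o List∈.∈ acyclicOrientations (G ↾ U) → Nonempty U →
                ∃ λ v → v ∈ U × IsSink (G ↾ U) o v
  sink-exists {U} {o} o∈ U≠∅
    with any? (λ v → (v ∈? U) ×-dec isSink? (G ↾ U) o v) | ∈-acyclicOrientations⁻ (G ↾ U) o∈
  ... | yes sink | _ = sink
  ... | no none  | _ , (o⊆ , one) , acyclic = contradiction next (acyclic⇒terminal acyclic U≠∅)
    where
    next : ∀ v → v ∈ U → ∃ λ w → w ∈ U × (v , w) ∈ₐ o
    next v v∈U with ¬∀⟶∃¬ d _ (λ u → SimpleGraph.adj? (G ↾ U) u v →-dec ((u , v) ∈ₐ? o))
                        (λ sink → none (v , v∈U , sink))
    ... | u , ¬sink with SimpleGraph.adj? (G ↾ U) u v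
    ...   | no ¬adj = contradiction (λ adj → contradiction adj ¬adj) ¬sink
    ...   | yes adj@(u∈U , _) with one u v adj
    ...     | inj₁ (uv , _) = contradiction (λ _ → uv) ¬sink
    ...     | inj₂ (_ , vu) = u , u∈U , vu

  -- Acyclic orientations of G[U] whose sinks include the independent set T correspond to
  -- acyclic orientations of G[U ∖ T]: delete, resp. add, the arcs into T.
  module DeleteSinks {U T S : Subset d} (s : Split U T S) where

    AllSinks : Arcs d → Set
    AllSinks o = ∀ v → v ∈ T → IsSink (G ↾ U) o v

    allSinks? : Decidable AllSinks
    allSinks? o = all? λ v → (v ∈? T) →-dec isSink? (G ↾ U) o v

    deleted? : ∀ o → Decidable (λ (a : Fin d × Fin d) → a ∈ₐ o × ¬ proj₂ a ∈ T)
    deleted? o a = (a ∈ₐ? o) ×-dec ¬? (proj₂ a ∈? T)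

    added? : ∀ o → Decidable (λ (a : Fin d × Fin d) →
               a ∈ₐ o ⊎ (proj₂ a ∈ T × SimpleGraph.Adj (G ↾ U) (proj₁ a) (proj₂ a)))
    added? o a = (a ∈ₐ? o) ⊎-dec ((proj₂ a ∈? T) ×-dec SimpleGraph.adj? (G ↾ U) (proj₁ a) (proj₂ a))

    delete add : Arcs d → Arcs d
    delete o = filter (deleted? o) (allArcs d)
    add    o = filter (added? o) (allArcs d)

    ∈-delete⁺ : ∀ {o a} → a ∈ₐ o → ¬ proj₂ a ∈ T → a ∈ₐ delete o
    ∈-delete⁺ {o} a∈ a∉T = ∈-filter⁺ (deleted? o) (∈-allArcs _) (a∈ , a∉T)

    ∈-delete⁻ : ∀ {o a} → a ∈ₐ delete o → a ∈ₐ o × ¬ proj₂ a ∈ T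
    ∈-delete⁻ {o} a∈ = proj₂ (∈-filter⁻ (deleted? o) {xs = allArcs d} a∈)

    ∈-add⁺ : ∀ {o u v} → (u , v) ∈ₐ o ⊎ (v ∈ T × SimpleGraph.Adj (G ↾ U) u v) → (u , v) ∈ₐ add o
    ∈-add⁺ {o} = ∈-filter⁺ (added? o) (∈-allArcs _)

    ∈-add⁻ : ∀ {o u v} → (u , v) ∈ₐ add o → (u , v) ∈ₐ o ⊎ (v ∈ T × SimpleGraph.Adj (G ↾ U) u v)
    ∈-add⁻ {o} a∈ = proj₂ (∈-filter⁻ (added? o) {xs = allArcs d} a∈)

    no-arc-from-T : ∀ {o} → IsOrientation (G ↾ U) o → AllSinks o →
                    ∀ {u v} → (u , v) ∈ₐ o → ¬ u ∈ T
    no-arc-from-T orient@(o⊆ , _) sink {u} {v} uv u∈T = orientation-antisym (G ↾ U) orient uv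
      (sink u u∈T v (SimpleGraph.adj-sym (G ↾ U) (All.lookup o⊆ uv)))

    allSinks⇒independent : ∀ {o} → IsOrientation (G ↾ U) o → AllSinks o → Independent G T
    allSinks⇒independent orient sink u v u∈T v∈T u~v =
      no-arc-from-T orient sink
        (sink v v∈T u (Split⇒⊆ˡ s u∈T , Split⇒⊆ˡ s v∈T , u~v)) u∈T

    delete-acyclicOrientation : ∀ {o} → IsAcyclicOrientation (G ↾ U) o → AllSinks o →
                                IsAcyclicOrientation (G ↾ S) (delete o)
    delete-acyclicOrientation {o} (orient@(o⊆ , one) , acyclic) sink =
      (All.tabulate (λ a∈ → inS (∈-delete⁻ a∈)) , oneS) ,
      acyclic-⊆ (proj₁ ∘ ∈-delete⁻) acyclic
      where
      ∈S : ∀ {v} → v ∈ U → ¬ v ∈ T → v ∈ S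
      ∈S v∈U v∉T with Split⇒∈ s v∈U
      ... | inj₁ v∈T = contradiction v∈T v∉T
      ... | inj₂ v∈S = v∈S
      inS : ∀ {u v} → (u , v) ∈ₐ o × ¬ v ∈ T → SimpleGraph.Adj (G ↾ S) u v
      inS (uv , v∉T) with All.lookup o⊆ uv
      ... | u∈U , v∈U , u~v = ∈S u∈U (no-arc-from-T orient sink uv) , ∈S v∈U v∉T , u~v
      oneS : ∀ u v → SimpleGraph.Adj (G ↾ S) u v →
             ((u , v) ∈ₐ delete o × ¬ (v , u) ∈ₐ delete o)
           ⊎ (¬ (u , v) ∈ₐ delete o × (v , u) ∈ₐ delete o)
      oneS u v (u∈S , v∈S , u~v) with one u v (Split⇒⊆ʳ s u∈S , Split⇒⊆ʳ s v∈S , u~v)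
      ... | inj₁ (uv , ¬vu) = inj₁
        (∈-delete⁺ uv (λ v∈T → Split⇒disjoint s v∈T v∈S) , ¬vu ∘ proj₁ ∘ ∈-delete⁻)
      ... | inj₂ (¬uv , vu) = inj₂
        (¬uv ∘ proj₁ ∘ ∈-delete⁻ , ∈-delete⁺ vu (λ u∈T → Split⇒disjoint s u∈T u∈S))

    add-acyclicOrientation : ∀ {o} → Independent G T → IsAcyclicOrientation (G ↾ S) o →
                             IsAcyclicOrientation (G ↾ U) (add o)
    add-acyclicOrientation {o} T-indep ((o⊆ , one) , acyclic) =
      (All.tabulate (λ a∈ → inU (∈-add⁻ a∈)) , oneU) , acyclicU
      where
      inU : ∀ {u v} → (u , v) ∈ₐ o ⊎ (v ∈ T × SimpleGraph.Adj (G ↾ U) u v) →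
            SimpleGraph.Adj (G ↾ U) u v
      inU (inj₁ uv) with All.lookup o⊆ uv
      ... | u∈S , v∈S , u~v = Split⇒⊆ʳ s u∈S , Split⇒⊆ʳ s v∈S , u~v
      inU (inj₂ (_ , adj)) = adj
      no-arc-from-T′ : ∀ {u v} → (u , v) ∈ₐ add o → ¬ u ∈ T
      no-arc-from-T′ {u} {v} uv u∈T with ∈-add⁻ uv
      ... | inj₁ uv′ = Split⇒disjoint s u∈T (proj₁ (All.lookup o⊆ uv′))
      ... | inj₂ (v∈T , _ , _ , u~v) = T-indep u v u∈T v∈T u~v
      oneU : ∀ u v → SimpleGraph.Adj (G ↾ U) u v →
             ((u , v) ∈ₐ add o × ¬ (v , u) ∈ₐ add o) ⊎ (¬ (u , v) ∈ₐ add o × (v , u) ∈ₐ add o)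
      oneU u v adj@(u∈U , v∈U , u~v) with Split⇒∈ s u∈U | Split⇒∈ s v∈U
      ... | _        | inj₁ v∈T = inj₁ (∈-add⁺ (inj₂ (v∈T , adj)) , λ vu → no-arc-from-T′ vu v∈T)
      ... | inj₁ u∈T | inj₂ _   =
        inj₂ ((λ uv → no-arc-from-T′ uv u∈T) , ∈-add⁺ (inj₂ (u∈T , v∈U , u∈U , adj-sym u~v)))
      ... | inj₂ u∈S | inj₂ v∈S with one u v (u∈S , v∈S , u~v)
      ...   | inj₁ (uv , ¬vu) = inj₁ (∈-add⁺ (inj₁ uv) ,
              λ vu → [ ¬vu , (λ (u∈T , _) → Split⇒disjoint s u∈T u∈S) ]′ (∈-add⁻ vu))
      ...   | inj₂ (¬uv , vu) = inj₂
              ((λ uv → [ ¬uv , (λ (v∈T , _) → Split⇒disjoint s v∈T v∈S) ]′ (∈-add⁻ uv)) ,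
               ∈-add⁺ (inj₁ vu))
      -- every vertex of a directed cycle has an arc leaving it, so no cycle meets T
      acyclicU : Acyclic (add o)
      acyclicU v vs (vs! , linked) = acyclic v vs (vs! ,
        Linked-successors {R = λ x y → (x , y) ∈ₐ add o} {R′ = λ x y → (x , y) ∈ₐ o} step
          (v ∷ vs) linked (proj₂ (cycle-successor vs linked)))
        where
        step : ∀ {x y z} → (x , y) ∈ₐ add o → (y , z) ∈ₐ add o → (x , y) ∈ₐ o
        step xy yz with ∈-add⁻ xy
        ... | inj₁ xy′       = xy′
        ... | inj₂ (y∈T , _) = contradiction y∈T (no-arc-from-T′ yz)

    -- Because `T` consists of sinks, the arcs of `o` into `T` are all edges of `G ↾ U` directed
    -- into `T`, exactly what `add` restores.
    add-delete : ∀ {o} → o List∈.∈ sublists (allArcs d) → IsOrientation (G ↾ U) o → AllSinks o →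
                 add (delete o) ≡ o
    add-delete {o} o∈ (o⊆ , _) sink = sublists-ext (allArcs-! d)
      (filter-∈-sublists (added? (delete o)) (allArcs d)) o∈
      (λ a∈ → [ proj₁ ∘ ∈-delete⁻ , (λ (v∈T , adj) → sink _ v∈T _ adj) ]′ (∈-add⁻ a∈))
      (λ {a} a∈ → ∈-add⁺ (back a∈ (proj₂ a ∈? T)))
      where
      back : ∀ {u v} → (u , v) ∈ₐ o → Dec (v ∈ T) →
             (u , v) ∈ₐ delete o ⊎ (v ∈ T × SimpleGraph.Adj (G ↾ U) u v)
      back uv (yes v∈T) = inj₂ (v∈T , All.lookup o⊆ uv)
      back uv (no v∉T)  = inj₁ (∈-delete⁺ uv v∉T)

    delete-add : ∀ {o} → o List∈.∈ sublists (allArcs d) → IsOrientation (G ↾ S) o →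
                 delete (add o) ≡ o
    delete-add {o} o∈ (o⊆ , _) = sublists-ext (allArcs-! d)
      (filter-∈-sublists (deleted? (add o)) (allArcs d)) o∈
      (λ a∈ → let (a∈add , v∉T) = ∈-delete⁻ a∈ in
        [ id , (λ (v∈T , _) → contradiction v∈T v∉T) ]′ (∈-add⁻ a∈add))
      (λ a∈ → ∈-delete⁺ (∈-add⁺ (inj₁ a∈))
        (λ v∈T → Split⇒disjoint s v∈T (proj₁ (proj₂ (All.lookup o⊆ a∈)))))

    length-allSinks : Independent G T →
      length (filter allSinks? (acyclicOrientations (G ↾ U))) ≡ length (acyclicOrientations (G ↾ S))
    length-allSinks T-indep = bijection⇒length≡
      (Unique.filter⁺ allSinks? (acyclicOrientations-! (G ↾ U))) (acyclicOrientations-! (G ↾ S))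
      delete add
      (λ o∈ → let (o∈′ , sink)    = ∈-filter⁻ allSinks? {xs = acyclicOrientations (G ↾ U)} o∈
                  (o∈″ , acyclic) = ∈-acyclicOrientations⁻ (G ↾ U) o∈′
              in ∈-acyclicOrientations⁺ (G ↾ S) (filter-∈-sublists (deleted? _) (allArcs d))
                   (delete-acyclicOrientation acyclic sink) ,
                 add-delete o∈″ (proj₁ acyclic) sink)
      (λ o∈ → let (o∈′ , acyclic) = ∈-acyclicOrientations⁻ (G ↾ S) o∈
              in ∈-filter⁺ allSinks?
                   (∈-acyclicOrientations⁺ (G ↾ U) (filter-∈-sublists (added? _) (allArcs d))
                     (add-acyclicOrientation T-indep acyclic))
                   (λ v v∈T u adj → ∈-add⁺ (inj₂ (v∈T , adj))) ,
                 delete-add o∈′ (proj₁ acyclic))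

  length-acyclicOrientations-⊥ : length (acyclicOrientations (G ↾ ⊥)) ≡ 1
  length-acyclicOrientations-⊥ = bijection⇒length≡ {ys = [ [] ]}
    (acyclicOrientations-! (G ↾ ⊥)) ([] ∷ []) id id
    (λ o∈ → here (no-arcs (∈-acyclicOrientations⁻ (G ↾ ⊥) o∈)) , ≡.refl)
    λ { (here ≡.refl) → ∈-acyclicOrientations⁺ (G ↾ ⊥) ([]∈sublists (allArcs d))
          (([] , λ u v (u∈⊥ , _) → contradiction u∈⊥ ∉⊥) ,
           λ { v [] (_ , () ∷ _) ; v (_ ∷ _) (_ , () ∷ _) }) , ≡.refl }
    where
    no-arcs : ∀ {o} → o List∈.∈ sublists (allArcs d) × IsAcyclicOrientation (G ↾ ⊥) o → o ≡ []
    no-arcs {[]}    _                               = ≡.refl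
    no-arcs {_ ∷ _} (_ , ((u∈⊥ , _) ∷ _ , _) , _) = contradiction u∈⊥ ∉⊥
    []∈sublists : ∀ {A : Set} (xs : List A) → [] List∈.∈ sublists xs
    []∈sublists []       = here ≡.refl
    []∈sublists (x ∷ xs) = ∈-++⁺ˡ ([]∈sublists xs)

  acyclicOrientations-↾⊤ : acyclicOrientations (G ↾ ⊤) ≡ acyclicOrientations G
  acyclicOrientations-↾⊤ = filter-≐ (isAcyclicOrientation? (G ↾ ⊤)) (isAcyclicOrientation? G)
    ( (λ ((o⊆ , one) , acyclic) →
        (All.map (proj₂ ∘ proj₂) o⊆ , λ u v u~v → one u v (∈⊤ , ∈⊤ , u~v)) , acyclic)
    , (λ ((o⊆ , one) , acyclic) →
        (All.map (λ u~v → ∈⊤ , ∈⊤ , u~v) o⊆ , λ u v (_ , _ , u~v) → one u v u~v) , acyclic))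
    (sublists (allArcs d))

-- The expansion

∣∣-Split : ∀ {U T S : Subset d} → Split U T S → ∣ U ∣ ≡ ∣ T ∣ ℕ.+ ∣ S ∣
∣∣-Split []      = ≡.refl
∣∣-Split (out s) = ∣∣-Split s
∣∣-Split (inˡ s) = ≡.cong suc (∣∣-Split s)
∣∣-Split (inʳ {T = T} {S} s) = ≡.trans (≡.cong suc (∣∣-Split s)) (≡.sym (ℕ.+-suc ∣ T ∣ ∣ S ∣))

Nonempty⇒∣∣ : ∀ {U : Subset d} → Nonempty U → ∃ λ n → ∣ U ∣ ≡ suc n
Nonempty⇒∣∣ {U = inside ∷ U}  _                     = ∣ U ∣ , ≡.refl
Nonempty⇒∣∣ {U = outside ∷ U} (Fin.suc v , there p) = Nonempty⇒∣∣ (v , p)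

-- Products over vertex sets

module Characters {c ℓ : Level} (R : CommutativeRing c ℓ) where

  open CommutativeRing R
  open SetFunctions R
  open Restriction R
  open SetoidReasoning setoid

  -- Stated for `tabulate f`, since the induction starting from `allFin`, which is `tabulate id`,
  -- replaces `f` by `f ∘ Fin.suc`.
  prod-filter : ∀ {n} {A : Set} (x : A → Carrier) {P : A → Set} (P? : Decidable P) (f : Fin n → A) →
    prod x (filter P? (List.tabulate f)) ≈ χ (x ∘ f) (setOf (P? ∘ f))
  prod-filter {zero}  x P? f = refl
  prod-filter {suc n} x P? f with does (P? (f Fin.zero))
  ... | true  = *-congˡ (prod-filter x P? (f ∘ Fin.suc))
  ... | false = prod-filter x P? (f ∘ Fin.suc)

  χ-⊥ : ∀ {d} (t : Fin d → Carrier) → χ t ⊥ ≈ 1#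
  χ-⊥ {zero}  t = refl
  χ-⊥ {suc d} t = χ-⊥ (t ∘ Fin.suc)

  χ-zero : ∀ (t : Fin d → Carrier) {U v} → v ∈ U → t v ≈ 0# → χ t U ≈ 0#
  χ-zero t                     here          tv≈0 = trans (*-congʳ tv≈0) (zeroˡ _)
  χ-zero t {U = outside ∷ U} (there v∈U) tv≈0 = χ-zero (t ∘ Fin.suc) v∈U tv≈0
  χ-zero t {U = inside ∷ U}  (there v∈U) tv≈0 =
    trans (*-congˡ (χ-zero (t ∘ Fin.suc) v∈U tv≈0)) (zeroʳ _)

  χ-⊤ : ∀ (t x : Fin d → Carrier) K → (∀ v → v ∈ K → t v ≈ x v) → (∀ v → ¬ v ∈ K → t v ≈ 1#) →
        χ t ⊤ ≈ χ x K
  χ-⊤ t x []            _  _  = refl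
  χ-⊤ t x (outside ∷ K) t∈ t∉ = trans (*-cong (t∉ Fin.zero λ ())
    (χ-⊤ _ _ K (λ v → t∈ _ ∘ there) (λ v v∉K → t∉ _ λ { (there v∈K) → v∉K v∈K })))
    (*-identityˡ _)
  χ-⊤ t x (inside ∷ K)  t∈ t∉ = *-cong (t∈ Fin.zero here)
    (χ-⊤ _ _ K (λ v → t∈ _ ∘ there) (λ v v∉K → t∉ _ λ { (there v∈K) → v∉K v∈K }))

  -- Multiplying out the product of the factors 1 + `t v` selects a subset T of `U`.
  ∑split-χ : ∀ (t : Fin d → Carrier) U → ∑split U (λ T _ → χ t T) ≈ χ (λ v → 1# + t v) U
  ∑split-χ t []            = refl
  ∑split-χ t (outside ∷ U) = ∑split-χ (t ∘ Fin.suc) U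
  ∑split-χ t (inside ∷ U)  = begin
    ∑split U (λ T _ → χ t′ T) + ∑split U (λ T _ → t Fin.zero * χ t′ T)
      ≈⟨ +-cong (sym (*-identityˡ _)) (∑split-*ˡ U (t Fin.zero) (λ T _ → χ t′ T)) ⟩
    1# * ∑split U (λ T _ → χ t′ T) + t Fin.zero * ∑split U (λ T _ → χ t′ T)
      ≈⟨ distribʳ _ _ _ ⟨
    (1# + t Fin.zero) * ∑split U (λ T _ → χ t′ T)
      ≈⟨ *-congˡ (∑split-χ t′ U) ⟩
    (1# + t Fin.zero) * χ (λ v → 1# + t′ v) U ∎
    where t′ = t ∘ Fin.suc

  sum-one : ∀ {A B : Set} (xs : List A) (ys : List B) → length xs ≡ length ys →
            sum (λ _ → 1#) xs ≈ sum (λ _ → 1#) ys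
  sum-one []       []       _  = refl
  sum-one (_ ∷ xs) (_ ∷ ys) eq = +-congˡ (sum-one xs ys (ℕ.suc-injective eq))

  ind-∈ : ∀ {B : Subset d} {v} → v ∈ B → ind B v ≈ 1#
  ind-∈ v∈B = reflexive (≡.cong (if_then 1# else 0#) (Vec.[]=⇒lookup v∈B))

  ind-∉ : ∀ (B : Subset d) v → ¬ v ∈ B → ind B v ≈ 0#
  ind-∉ (outside ∷ B) Fin.zero    v∉B = refl
  ind-∉ (inside ∷ B)  Fin.zero    v∉B = contradiction here v∉B
  ind-∉ (_ ∷ B)       (Fin.suc v) v∉B = ind-∉ B v (v∉B ∘ there)

-- Counting sinks by convolution

module Expansion {c ℓ : Level} (R : CommutativeRing c ℓ) {d : ℕ} (G : SimpleGraph d) where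

  open CommutativeRing R
  open RingProperties ring
    using (-1*x≈-x; -0#≈0#; -‿distribˡ-*; -‿distribʳ-*; -‿involutive; -‿+-comm)
  open SetFunctions R
  open Restriction R
  open Characters R
  open BondSums R G
  open SetoidReasoning setoid

  #acyclic : SetFunction d
  #acyclic U = sum (λ _ → 1#) (acyclicOrientations (G ↾ U))

  -- The left side counts the orientations in which all of `T` are sinks. For independent `T`
  -- deletion is a bijection; otherwise there are none, since adjacent vertices cannot both be
  -- sinks, and `indep T` vanishes too.
  sum-χ-sinkSet : ∀ {U T S} → Split U T S →
    sum (λ o → χ (ind (sinkSet (G ↾ U) o)) T) (acyclicOrientations (G ↾ U)) ≈ indep T * #acyclic S
  sum-χ-sinkSet {U} {T} {S} s = trans (sum-cong (acyclicOrientations (G ↾ U)) χ≈when)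
    (cases (independent? G T))
    where
    open DeleteSinks G s
    χ≈when : ∀ o → χ (ind (sinkSet (G ↾ U) o)) T ≈ when (allSinks? o) 1#
    χ≈when o with T ⊆? sinkSet (G ↾ U) o
    ... | yes T⊆K = trans (χ-ind-⊆ T⊆K) (sym (when-yes (allSinks? o)
                      (λ v v∈T → ∈-setOf⁻ (isSink? (G ↾ U) o) (T⊆K v∈T))))
    ... | no T⊈K  = trans (χ-ind-⊈ T⊈K) (sym (when-no (allSinks? o)
                      (λ sink → T⊈K (λ {v} v∈T → ∈-setOf⁺ (isSink? (G ↾ U) o) (sink v v∈T)))))
    cases : Dec (Independent G T) →
            sum (λ o → when (allSinks? o) 1#) (acyclicOrientations (G ↾ U)) ≈ indep T * #acyclic S
    cases (yes T-indep) = begin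
      sum (λ o → when (allSinks? o) 1#) (acyclicOrientations (G ↾ U))
        ≈⟨ sum-filter allSinks? (acyclicOrientations (G ↾ U))
             (λ {o} _ sink → sym (when-yes (allSinks? o) sink))
             (λ {o} _ ¬sink → when-no (allSinks? o) ¬sink) ⟨
      sum (λ _ → 1#) (filter allSinks? (acyclicOrientations (G ↾ U)))
        ≈⟨ sum-one (filter allSinks? (acyclicOrientations (G ↾ U))) (acyclicOrientations (G ↾ S))
             (length-allSinks T-indep) ⟩
      #acyclic S
        ≈⟨ trans (*-congʳ (indep-yes T-indep)) (*-identityˡ _) ⟨
      indep T * #acyclic S ∎
    cases (no T-dep) = trans
      (sum-zero (acyclicOrientations (G ↾ U)) λ {o} o∈ → when-no (allSinks? o) λ sink →
        T-dep (allSinks⇒independent (proj₁ (proj₂ (∈-acyclicOrientations⁻ (G ↾ U) o∈))) sink))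
      (sym (trans (*-congʳ (indep-no T-dep)) (zeroˡ _)))

  -- Both sides expand to the sum of ∏_{v ∈ T} t v over the pairs (o , T) where T ⊆ U consists
  -- of sinks of o.
  indep⋆#acyclic : ∀ t U → (t ⊙ indep ⋆ #acyclic) U ≈
    sum (λ o → χ (λ v → 1# + t v * ind (sinkSet (G ↾ U) o) v) U) (acyclicOrientations (G ↾ U))
  indep⋆#acyclic t U = begin
    ∑split U (λ T S → χ t T * indep T * #acyclic S)
      ≈⟨ ∑split-cong U (λ s → trans (*-assoc _ _ _) (*-congˡ (sym (sum-χ-sinkSet s)))) ⟩
    ∑split U (λ T _ → χ t T * sum (λ o → χ (K o) T) (acyclicOrientations (G ↾ U)))
      ≈⟨ ∑split-cong U (λ {T} _ → trans
           (sym (sum-*ˡ (χ t T) (λ o → χ (K o) T) (acyclicOrientations (G ↾ U))))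
           (sum-cong (acyclicOrientations (G ↾ U)) (λ o → sym (χ-* t (K o) T)))) ⟩
    ∑split U (λ T _ → sum (λ o → χ (λ v → t v * K o v) T) (acyclicOrientations (G ↾ U)))
      ≈⟨ ∑split-sum U (λ o T _ → χ (λ v → t v * K o v) T) (acyclicOrientations (G ↾ U)) ⟩
    sum (λ o → ∑split U (λ T _ → χ (λ v → t v * K o v) T)) (acyclicOrientations (G ↾ U))
      ≈⟨ sum-cong (acyclicOrientations (G ↾ U)) (λ o → ∑split-χ (λ v → t v * K o v) U) ⟩
    sum (λ o → χ (λ v → 1# + t v * K o v) U) (acyclicOrientations (G ↾ U)) ∎
    where
    K : Arcs d → Fin d → Carrier
    K o = ind (sinkSet (G ↾ U) o)

  sign : Fin d → Carrier
  sign _ = - 1#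

  -- With t = -1 a sink contributes the factor 1 - 1 = 0, so an orientation with a sink in `U`
  -- contributes nothing.
  indep⋆#acyclic≐δ : sign ⊙ indep ⋆ #acyclic ≐ δ
  indep⋆#acyclic≐δ U = trans (indep⋆#acyclic sign U) (cases (nonempty? U))
    where
    nonSink : ∀ U → Arcs d → Fin d → Carrier
    nonSink U o v = 1# + - 1# * ind (sinkSet (G ↾ U) o) v
    cases : Dec (Nonempty U) →
            sum (λ o → χ (nonSink U o) U) (acyclicOrientations (G ↾ U)) ≈ δ U
    cases (yes U≠∅) = trans
      (sum-zero (acyclicOrientations (G ↾ U)) λ {o} o∈ →
        let (v , v∈U , sink) = sink-exists G o∈ U≠∅
            v∈K              = ∈-setOf⁺ (isSink? (G ↾ U) o) sink
        in χ-zero (nonSink U o) v∈U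
             (trans (+-congˡ (trans (*-congˡ (ind-∈ v∈K)) (*-identityʳ _))) (-‿inverseʳ 1#)))
      (sym (δ-Nonempty U≠∅))
    cases (no U≡∅) with Empty-unique U≡∅
    -- The single orientation of the edgeless graph contributes an empty product; the one-element
    -- list serves to compare lengths.
    ... | ≡.refl = trans (sum-cong (acyclicOrientations (G ↾ ⊥)) (λ o → χ-⊥ (nonSink ⊥ o)))
      (trans (sum-one (acyclicOrientations (G ↾ ⊥)) (⊥ {d} ∷ []) (length-acyclicOrientations-⊥ G))
        (trans (+-identityʳ 1#) (sym (δ-⊥ {d}))))

  module _ {ι : ℤ → Carrier} (ι-hom : IsRingHomomorphism ℤ.+-*-rawRing rawRing ι) where
    open IsRingHomomorphism ι-hom

    ι-1 : ι -1ℤ ≈ - 1#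
    ι-1 = trans (-‿homo 1ℤ) (-‿cong 1#-homo)

    ι-sign : ∀ {n} (U : Subset n) → χ (λ _ → - 1#) U ≈ ι (-1ℤ ℤ.^ ∣ U ∣)
    ι-sign []            = sym 1#-homo
    ι-sign (outside ∷ U) = ι-sign U
    ι-sign (inside ∷ U)  =
      trans (*-cong (sym ι-1) (ι-sign U)) (sym (*-homo -1ℤ (-1ℤ ℤ.^ ∣ U ∣)))

    ι-sign-block : ∀ {B : Subset d} {n} → ∣ B ∣ ≡ suc n → - χ sign B ≈ ι (-1ℤ ℤ.^ n)
    ι-sign-block {B} {n} ∣B∣≡1+n = begin
      - χ sign B                    ≈⟨ -‿cong (ι-sign B) ⟩
      - ι (-1ℤ ℤ.^ ∣ B ∣)           ≡⟨ ≡.cong (λ k → - ι (-1ℤ ℤ.^ k)) ∣B∣≡1+n ⟩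
      - ι (-1ℤ ℤ.* -1ℤ ℤ.^ n)       ≡⟨ ≡.cong (-_ ∘ ι) (ℤ.-1*i≡-i (-1ℤ ℤ.^ n)) ⟩
      - ι (ℤ.- (-1ℤ ℤ.^ n))         ≈⟨ -‿cong (-‿homo _) ⟩
      - - ι (-1ℤ ℤ.^ n)             ≈⟨ -‿involutive _ ⟩
      ι (-1ℤ ℤ.^ n)                 ∎

    -- The witness n is the sum of |B| - 1 over the blocks. Stating |U| = |π| + n avoids truncated
    -- subtraction in the induction.
    ι-sign-Tiles : ∀ {π : Blocks d} {U} → All Nonempty π → Tiles π U →
      ∃ λ n → ∣ U ∣ ≡ length π ℕ.+ n × prod (λ B → - χ sign B) π ≈ ι (-1ℤ ℤ.^ n)
    ι-sign-Tiles []          []      = 0 , ∣⊥∣≡0 d , sym 1#-homo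
    ι-sign-Tiles {B ∷ π} (B≠∅ ∷ π≠∅) (s ∷ t) with Nonempty⇒∣∣ B≠∅ | ι-sign-Tiles π≠∅ t
    ... | m , ∣B∣≡1+m | n , ∣S∣≡ , prod≈ =
      m ℕ.+ n ,
      ≡.trans (∣∣-Split s) (≡.trans (≡.cong₂ ℕ._+_ ∣B∣≡1+m ∣S∣≡)
        (≡.cong suc (≡.trans (≡.sym (ℕ.+-assoc m (length π) n))
          (≡.trans (≡.cong (ℕ._+ n) (ℕ.+-comm m (length π))) (ℕ.+-assoc (length π) m n))))) ,
      trans (*-cong (ι-sign-block {B} ∣B∣≡1+m) prod≈)
        (trans (sym (*-homo _ _)) (reflexive (≡.cong ι (≡.sym (ℤ.^-distribˡ-+-* -1ℤ m n)))))

    ι-sign-partition : ∀ {π : Blocks d} → IsPartition π →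
      ι (-1ℤ ℤ.^ (d ∸ length π)) ≈ prod (λ B → - χ sign B) π
    ι-sign-partition {π} π-part@(π≠∅ , _) with ι-sign-Tiles π≠∅ (IsPartition⇒Tiles π-part)
    ... | n , ∣⊤∣≡ , prod≈ = trans (reflexive (≡.cong (λ k → ι (-1ℤ ℤ.^ k))
      (≡.trans (≡.cong (_∸ length π) (≡.trans (≡.sym (∣⊤∣≡n d)) ∣⊤∣≡)) (ℕ.m+n∸m≡n (length π) n))))
      (sym prod≈)

    module _ (x : Fin d → Carrier) where

      private
        -- Chosen so that `1# + t v` equals `x v`: in `indep⋆#acyclic` a sink then contributes `x v`
        -- and any other vertex 1.
        y t : Fin d → Carrier
        y v = 1# - x v
        t v = - 1# * y v

        -- As `χ sign B` is (-1)^|B|, the extra minus in `ŵ` gives `w B` the sign (-1)^(|B|-1).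
        ŵ W block : SetFunction d
        ŵ B = - (χ sign B * w B)
        block B = 1# - prod y (filter (_∈? B) (allFin d))
        W B = ŵ B * block B

      block≈ : ∀ B → block B ≈ 1# - χ y B
      block≈ B = +-congˡ (-‿cong (trans (prod-filter y (_∈? B) id)
        (reflexive (≡.cong (χ y) (setOf-∈ B)))))
        where
        setOf-∈ : ∀ {n} (B : Subset n) → setOf (_∈? B) ≡ B
        setOf-∈ []            = ≡.refl
        setOf-∈ (outside ∷ B) = ≡.cong (outside ∷_) (setOf-∈ B)
        setOf-∈ (inside ∷ B)  = ≡.cong (inside ∷_) (setOf-∈ B)

      W≐ : W ≐ ŵ ⊕ t ⊙ w
      W≐ B = begin
        ŵ B * block B
          ≈⟨ *-congˡ (block≈ B) ⟩
        ŵ B * (1# - χ y B)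
          ≈⟨ trans (distribˡ _ _ _) (+-congʳ (*-identityʳ _)) ⟩
        ŵ B + ŵ B * - χ y B
          ≈⟨ +-congˡ (trans (sym (-‿distribˡ-* _ _))
               (trans (-‿cong (sym (-‿distribʳ-* _ _))) (-‿involutive _))) ⟩
        ŵ B + χ sign B * w B * χ y B
          ≈⟨ +-congˡ (trans (*-assoc _ _ _) (trans (*-congˡ (*-comm _ _)) (sym (*-assoc _ _ _)))) ⟩
        ŵ B + χ sign B * χ y B * w B
          ≈⟨ +-congˡ (*-congʳ (χ-* sign y B)) ⟨
        ŵ B + χ t B * w B ∎

      Eŵ≐#acyclic : E ŵ ≐ #acyclic
      Eŵ≐#acyclic = ⋆-inverse-unique (sign ⊙ indep) (E ŵ) #acyclic
        (≐-trans (⋆-congʳ {g = E ŵ} (≐-trans (⊙-cong sign (≐-sym E-w)) (≐-sym (E-⊙ sign w))))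
                 -- By computation `ŵ` is `neg (sign ⊙ w)`.
                 (E-inverse (sign ⊙ w)))
        indep⋆#acyclic≐δ

      ŵ-zero : ∀ B → w B ≈ 0# → ŵ B ≈ 0#
      ŵ-zero B wB≈0 = trans (-‿cong (trans (*-congˡ wB≈0) (zeroʳ _))) (-0#≈0#)

      W-zero : ∀ B → w B ≈ 0# → W B ≈ 0#
      W-zero B wB≈0 = trans (*-congʳ (ŵ-zero B wB≈0)) (zeroˡ _)

      bond-term : ∀ {π} → π List∈.∈ bonds G →
        ι (-1ℤ ℤ.^ (d ∸ length π) ℤ.* μ G 0̂ π) * prod block π ≈ prod W π
      bond-term {π} π∈ = begin
        ι (-1ℤ ℤ.^ (d ∸ length π) ℤ.* μ G 0̂ π) * prod block π
          ≈⟨ *-congʳ (trans (*-homo _ _)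
               (*-cong (ι-sign-partition (proj₁ (proj₂ (∈-bonds⁻ G π∈)))) (ι-μ ι-hom π∈))) ⟩
        prod (λ B → - χ sign B) π * prod w π * prod block π
          ≈⟨ *-congʳ (prod-* _ w π) ⟨
        prod (λ B → - χ sign B * w B) π * prod block π
          ≈⟨ *-congʳ (prod-cong {xs = π} (All.tabulate λ _ → sym (-‿distribˡ-* _ _))) ⟩
        prod ŵ π * prod block π
          ≈⟨ prod-* ŵ block π ⟨
        prod W π ∎

      sinks-term : ∀ o → χ (λ v → 1# + t v * ind (sinkSet (G ↾ ⊤) o) v) ⊤ ≈ prod x (sinks G o)
      sinks-term o = trans
        (χ-⊤ _ x (sinkSet G o)
          (λ v v∈ → begin
            1# + t v * ind (sinkSet (G ↾ ⊤) o) v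
              ≈⟨ +-congˡ (trans (*-congˡ (ind-∈ (∈-setOf⁺ (isSink? (G ↾ ⊤) o)
                   λ u (_ , _ , u~v) → ∈-setOf⁻ (isSink? G o) v∈ u u~v)))
                   (trans (*-identityʳ _) (-1*x≈-x _))) ⟩
            1# - y v
              ≈⟨ +-congˡ (trans (sym (-‿+-comm _ _)) (+-congˡ (-‿involutive _))) ⟩
            1# + (- 1# + x v)
              ≈⟨ trans (sym (+-assoc _ _ _)) (trans (+-congʳ (-‿inverseʳ 1#)) (+-identityˡ _)) ⟩
            x v ∎)
          (λ v v∉ → trans (+-congˡ (trans (*-congˡ (ind-∉ _ v λ v∈ → v∉
              (∈-setOf⁺ (isSink? G o) λ u u~v → ∈-setOf⁻ (isSink? (G ↾ ⊤) o) v∈ u (∈⊤ , ∈⊤ , u~v))))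
              (zeroʳ _))) (+-identityʳ _)))
        (sym (prod-filter x (isSink? G o) id))

      expansion : sum (λ o → prod x (sinks G o)) (acyclicOrientations G) ≈
        sum (λ π → ι (-1ℤ ℤ.^ (d ∸ length π) ℤ.* μ G 0̂ π) * prod block π) (bonds G)
      expansion = sym (begin
        sum (λ π → ι (-1ℤ ℤ.^ (d ∸ length π) ℤ.* μ G 0̂ π) * prod block π) (bonds G)
          ≈⟨ sum-cong-∈ (bonds G) bond-term ⟩
        sum (prod W) (bonds G)
          ≈⟨ sum-bonds W (W-zero ⊥ (Log-⊥ indep)) (λ B → W-zero B ∘ w-disconnected B) ⟩
        E W ⊤
          ≈⟨ ≐-trans (E-cong (λ B _ → W≐ B)) (E-⊕ ŵ (t ⊙ w)) ⊤ ⟩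
        (E ŵ ⋆ E (t ⊙ w)) ⊤
          ≈⟨ ⋆-cong Eŵ≐#acyclic (≐-trans (E-⊙ t w) (⊙-cong t E-w)) ⊤ ⟩
        (#acyclic ⋆ t ⊙ indep) ⊤
          ≈⟨ ⋆-comm #acyclic (t ⊙ indep) ⊤ ⟩
        (t ⊙ indep ⋆ #acyclic) ⊤
          ≈⟨ indep⋆#acyclic t ⊤ ⟩
        sum (λ o → χ (λ v → 1# + t v * ind (sinkSet (G ↾ ⊤) o) v) ⊤) (acyclicOrientations (G ↾ ⊤))
          ≈⟨ sum-cong (acyclicOrientations (G ↾ ⊤)) sinks-term ⟩
        sum (λ o → prod x (sinks G o)) (acyclicOrientations (G ↾ ⊤))
          ≡⟨ ≡.cong (sum (λ o → prod x (sinks G o))) (acyclicOrientations-↾⊤ G) ⟩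
        sum (λ o → prod x (sinks G o)) (acyclicOrientations G) ∎)

open import Defs

theorem3p10 : (d : ℕ) (G : SimpleGraph d) →
    acyclicOrientationPolynomial G ≈
    ∑ (map (λ π → const (-1ℤ ℤ.^ (d ∸ length π) ℤ.* μ G 0̂ π) * ∏ (map blockPolynomial π))
    (bonds G))
-- At `polynomialRing` and `var` the general `sum`, `prod` and `block` unfold to `∑`, `∏` and
-- `blockPolynomial`, so only the passage from `_≋_` to `_≈_` remains.
theorem3p10 d G = ≋⇒≈ (expansion const-isRingHomomorphism var)
  where
  open PolynomialRing d
  open Expansion polynomialRing G
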